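{- Let $K$ be an imaginary quadratic field of discriminant $d_K$, let $\mathfrak{n}$ be a nontrivial (nonzero) ideal of $\mathcal{O}_K$ and let $N$ be the least positive integer in $\mathfrak{n}$. Let $Q=ax^2+bxy+cy^2$ and $Q'=a'x^2+b'xy+c'y^2$ be elements of $\mathcal{Q}_N(d_K)$. Take $\gamma\in\mathrm{SL}_2(\mathbb{Z})$ (one exists) such that the form $Q''=a''x^2+b''xy+c''y^2=Q'^{\,\gamma}$ satisfies $\gcd(a,\,a'',\,(b+b'')/2)=1$, and let $B$ be an integer (unique modulo $2aa''$) satisfying $$B\equiv b\pmod{2a},\quad B\equiv b''\pmod{2a''},\quad B^2\equiv d_K\pmod{4aa''}.$$ Put $$\nu_1=\frac{ -B+\sqrt{d_K}}{2aa''\,j(\gamma,\,\omega_{Q''})},\qquad \nu_2=\frac{1}{j(\gamma,\,\omega_{Q''})}.$$ Then there exist $u,v\in\mathbb{Z}$ with $1=u\nu_1+v\nu_2$; for such $u,v$ one can take a matrix $\sigma\in\mathrm{SL}_2(\mathbb{Z})$ with $\sigma\equiv\begin{bmatrix}*&*\\ u&v\end{bmatrix}\pmod{NM_2(\mathbb{Z})}$, and in the group $\mathcal{Q}_N(d_K)/\sim_\mathfrak{n}$ one has $$[Q][Q']=\left[\left(aa''x^2+Bxy+\frac{B^2-d_K}{4aa''}y^2\right)^{\sigma^{ -1}}\right].$$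
   Context: $\mathcal{Q}(d_K)$ is the set of primitive positive definite integral binary quadratic forms $ax^2+bxy+cy^2$ of discriminant $d_K$; $\mathcal{Q}_N(d_K)$ is the subset of those with $\gcd(N,a)=1$. For $Q=ax^2+bxy+cy^2\in\mathcal{Q}(d_K)$, $\omega_Q=\frac{ -b+\sqrt{d_K}}{2a}$. For $\gamma\in\mathrm{SL}_2(\mathbb{Z})$, $Q^\gamma$ is the form $Q\left(\gamma\begin{bmatrix}x\\ y\end{bmatrix}\right)$. For a real $2\times2$ matrix $\alpha=\begin{bmatrix}p&q\\ r&s\end{bmatrix}$ of positive determinant and $\tau$ in the upper half-plane, $j(\alpha,\tau)=r\tau+s$. $[\alpha,\beta]=\mathbb{Z}\alpha+\mathbb{Z}\beta$. $\mathcal{C}(\mathfrak{n})=I_K(\mathfrak{n})/P_{K,1}(\mathfrak{n})$ is the ray class group modulo $\mathfrak{n}$, where $I_K(\mathfrak{n})$ is the group of fractional ideals relatively prime to $\mathfrak{n}$ and $P_{K,1}(\mathfrak{n})=\{\nu\mathcal{O}_K\mid\nu\in K^*,\ \nu\equiv^*1\pmod{\mathfrak{n}}\}$. For $Q,Q'\in\mathcal{Q}_N(d_K)$, $Q\sim_\mathfrak{n}Q'$ means $[[\omega_Q,1]]=[[\omega_{Q'},1]]$ in $\mathcal{C}(\mathfrak{n})$. The map $[Q]\mapsto[[\omega_Q,1]]$ is a bijection $\mathcal{Q}_N(d_K)/\sim_\mathfrak{n}\to\mathcal{C}(\mathfrak{n})$, and the group structure on $\mathcal{Q}_N(d_K)/\sim_\mathfrak{n}$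 is the one transported from $\mathcal{C}(\mathfrak{n})$ through it. -}

module Defs where

open import Level using (0ℓ)
open import Data.Nat.Base as ℕ using (ℕ)
import Data.Nat.Divisibility as ℕ
open import Data.Integer.Base using (ℤ; +_; 0ℤ; 1ℤ; _+_; _-_; _*_; -_; _<_; _%ℕ_; _/ℕ_; ∣_∣)
open import Data.Integer.Divisibility.Signed using (_∣_)
open import Data.Integer.GCD using (gcd)
open import Data.Integer.Tactic.RingSolver using (solve-∀)
open import Data.Rational.Base as ℚ using (ℚ; 0ℚ; 1ℚ)
import Data.Rational.Properties as ℚ
open import Data.Product.Base using (∃; ∃₂; _×_)
open import Data.Sum.Base using (_⊎_)
open import Relation.Nullary.Decidable.Core using (yes; no)
open import Relation.Nullary.Negation.Core using (¬_)
open import Relation.Unary using (Pred; _∈_; _⊆_; _≐_)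
open import Relation.Binary.PropositionalEquality using (_≡_; trans)

------------------------------------------------------------------------
-- Discriminants of imaginary quadratic fields

SquareFree : ℤ → Set
SquareFree m = ∀ k → k ℕ.* k ℕ.∣ ∣ m ∣ → k ≡ 1

-- An imaginary quadratic field is ℚ(√m) for a unique squarefree m < 0; its
-- discriminant is m if m ≡ 1 (mod 4) and 4m otherwise.
record IsImaginaryQuadraticDiscriminant (d : ℤ) : Set where
  field
    radicand   : ℤ
    negative   : radicand < 0ℤ
    squareFree : SquareFree radicand
    value      : (radicand %ℕ 4 ≡ 1 × d ≡ radicand)
               ⊎ (¬ radicand %ℕ 4 ≡ 1 × d ≡ + 4 * radicand)

------------------------------------------------------------------------
-- The field K = ℚ(√d)

infix 8 _+√·_

-- p +√· q  is  p + q√d.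
record K (d : ℤ) : Set where
  constructor _+√·_
  field
    rat irr : ℚ

fromℚ : ∀ {d} → ℚ → K d
fromℚ p = p +√· 0ℚ

fromℤ : ∀ {d} → ℤ → K d
fromℤ n = fromℚ (n ℚ./ 1)

√disc : ∀ {d} → K d
√disc = 0ℚ +√· 1ℚ

module _ {d : ℤ} where

  infixl 6 _+ₖ_ _-ₖ_
  infixl 7 _*ₖ_

  0ₖ 1ₖ : K d
  0ₖ = fromℤ 0ℤ
  1ₖ = fromℤ 1ℤ

  _+ₖ_ _-ₖ_ _*ₖ_ : K d → K d → K d
  (p +√· q) +ₖ (r +√· s) = (p ℚ.+ r) +√· (q ℚ.+ s)
  (p +√· q) -ₖ (r +√· s) = (p ℚ.- r) +√· (q ℚ.- s)
  (p +√· q) *ₖ (r +√· s) =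
    (p ℚ.* r ℚ.+ (d ℚ./ 1) ℚ.* (q ℚ.* s)) +√· (p ℚ.* s ℚ.+ q ℚ.* r)

  norm : K d → ℚ
  norm (p +√· q) = p ℚ.* p ℚ.- (d ℚ./ 1) ℚ.* (q ℚ.* q)

-- Inversion and division are made total by 1/0 = 0.
invℚ : ℚ → ℚ
invℚ p with p ℚ.≟ 0ℚ
... | yes _  = 0ℚ
... | no p≢0 = ℚ.1/_ p {{ℚ.≢-nonZero p≢0}}

invₖ : ∀ {d} → K d → K d
invₖ z@(p +√· q) = (p ℚ.* invℚ (norm z)) +√· (ℚ.- q ℚ.* invℚ (norm z))

infixl 7 _/ₖ_

_/ₖ_ : ∀ {d} → K d → K d → K d
x /ₖ y = x *ₖ invₖ y

------------------------------------------------------------------------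
-- Lattices and ideals, as subsets of K

-- [ α , β ] = ℤα + ℤβ
[_,_] : ∀ {d} → K d → K d → Pred (K d) 0ℓ
[ α , β ] z = ∃₂ λ m n → z ≡ fromℤ m *ₖ α +ₖ fromℤ n *ₖ β

-- The ring of integers ℤ[(d+√d)/2], through its usual ℤ-basis.
𝒪 : ∀ {d} → Pred (K d) 0ℓ
𝒪 {d} = [ (fromℤ d +ₖ √disc) /ₖ fromℤ (+ 2) , 1ₖ ]

module _ {d : ℤ} where

  record IsNonzero𝒪Submodule (I : Pred (K d) 0ℓ) : Set where
    field
      0∈       : 0ₖ ∈ I
      +-closed : ∀ {x y} → x ∈ I → y ∈ I → x +ₖ y ∈ I
      𝒪-closed : ∀ {α x} → α ∈ 𝒪 → x ∈ I → α *ₖ x ∈ I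
      nonzero  : ∃ λ x → x ∈ I × ¬ x ≡ 0ₖ

  record IsNonzeroIdeal (I : Pred (K d) 0ℓ) : Set where
    field
      submodule : IsNonzero𝒪Submodule I
      integral  : I ⊆ 𝒪

  record IsFractionalIdeal (I : Pred (K d) 0ℓ) : Set where
    field
      submodule         : IsNonzero𝒪Submodule I
      denominator       : K d
      denominator∈𝒪     : denominator ∈ 𝒪
      denominator≢0     : ¬ denominator ≡ 0ₖ
      clearsDenominator : ∀ {x} → x ∈ I → denominator *ₖ x ∈ 𝒪

  infixl 7 _·_

  -- Finite sums of products xy with x ∈ I and y ∈ J.
  data _·_ (I J : Pred (K d) 0ℓ) : Pred (K d) 0ℓ where
    empty : 0ₖ ∈ I · J
    cons  : ∀ {x y z} → x ∈ I → y ∈ J → z ∈ I · J → x *ₖ y +ₖ z ∈ I · J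

  ⟨_⟩ : K d → Pred (K d) 0ℓ
  ⟨ ν ⟩ z = ∃ λ α → α ∈ 𝒪 × z ≡ ν *ₖ α

  -- A + 𝔫 = 𝒪, for ideals A and 𝔫 of 𝒪.
  Comaximal : (A 𝔫 : Pred (K d) 0ℓ) → Set
  Comaximal A 𝔫 = ∃₂ λ x y → x ∈ A × y ∈ 𝔫 × x +ₖ y ≡ 1ₖ

  record IsLeastPositiveInteger (𝔫 : Pred (K d) 0ℓ) (N : ℕ) : Set where
    field
      positive : 0 ℕ.< N
      member   : fromℤ (+ N) ∈ 𝔫
      least    : ∀ m → 0 ℕ.< m → fromℤ (+ m) ∈ 𝔫 → N ℕ.≤ m

------------------------------------------------------------------------
-- The ray class group modulo 𝔫

  -- Membership in I_K(𝔫): I = A B⁻¹ for integral ideals A, B prime to 𝔫.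
  record IsPrimeTo (𝔫 I : Pred (K d) 0ℓ) : Set₁ where
    field
      fractional  : IsFractionalIdeal I
      A B         : Pred (K d) 0ℓ
      A-ideal     : IsNonzeroIdeal A
      B-ideal     : IsNonzeroIdeal B
      A-comaximal : Comaximal A 𝔫
      B-comaximal : Comaximal B 𝔫
      quotient    : B · I ≐ A

  -- ν ≡* 1 (mod 𝔫) for ν ∈ K*: ν = α/β with α, β ∈ 𝒪 nonzero and prime to 𝔫
  -- such that α ≡ β (mod 𝔫).
  record _≡*1mod_ (ν : K d) (𝔫 : Pred (K d) 0ℓ) : Set where
    field
      ν≢0         : ¬ ν ≡ 0ₖ
      α β         : K d
      α∈𝒪         : α ∈ 𝒪
      β∈𝒪         : β ∈ 𝒪
      β≢0         : ¬ β ≡ 0ₖ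
      α-comaximal : Comaximal ⟨ α ⟩ 𝔫
      β-comaximal : Comaximal ⟨ β ⟩ 𝔫
      α≡β         : α -ₖ β ∈ 𝔫
      fraction    : ν ≡ α /ₖ β

  -- Equality of the classes of I and J in 𝒞(𝔫) = I_K(𝔫)/P_{K,1}(𝔫): both lie in
  -- I_K(𝔫), and I lies in the coset J · P_{K,1}(𝔫).
  record _≈_[mod_] (I J 𝔫 : Pred (K d) 0ℓ) : Set₁ where
    field
      I∈I_K[𝔫] : IsPrimeTo 𝔫 I
      J∈I_K[𝔫] : IsPrimeTo 𝔫 J
      ν        : K d
      ν≡*1     : ν ≡*1mod 𝔫
      coset    : I ≐ J · ⟨ ν ⟩

------------------------------------------------------------------------
-- SL₂(ℤ) and binary quadratic forms

-- The matrix with rows (p , q) and (r , s).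
record SL₂ℤ : Set where
  constructor mkSL₂
  field
    p q r s : ℤ
    det     : p * s - q * r ≡ 1ℤ

_⁻¹ : SL₂ℤ → SL₂ℤ
mkSL₂ p q r s det ⁻¹ = mkSL₂ s (- q) (- r) p (trans (lemma p q r s) det)
  where
  lemma : ∀ p q r s → s * p - (- q) * (- r) ≡ p * s - q * r
  lemma = solve-∀

j : ∀ {d} → SL₂ℤ → K d → K d
j γ τ = fromℤ r *ₖ τ +ₖ fromℤ s
  where open SL₂ℤ γ

-- form a b c  is  ax² + bxy + cy².
record Form : Set where
  constructor form
  field
    a b c : ℤ

eval : Form → ℤ → ℤ → ℤ
eval (form a b c) x y = a * (x * x) + b * (x * y) + c * (y * y)

-- The coefficients of Q(px+qy , rx+sy); see eval-action.
_^_ : Form → SL₂ℤ → Form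
Q@(form a b c) ^ mkSL₂ p q r s _ = form
  (eval Q p r)
  (+ 2 * a * (p * q) + b * (p * s + q * r) + + 2 * c * (r * s))
  (eval Q q s)

eval-action : ∀ Q γ x y → let open SL₂ℤ γ in
              eval (Q ^ γ) x y ≡ eval Q (p * x + q * y) (r * x + s * y)
eval-action (form a b c) (mkSL₂ p q r s _) x y = lemma a b c p q r s x y
  where
  lemma : ∀ a b c p q r s x y →
    (a * (p * p) + b * (p * r) + c * (r * r)) * (x * x)
      + (+ 2 * a * (p * q) + b * (p * s + q * r) + + 2 * c * (r * s)) * (x * y)
      + (a * (q * q) + b * (q * s) + c * (s * s)) * (y * y)
    ≡ a * ((p * x + q * y) * (p * x + q * y))
      + b * ((p * x + q * y) * (r * x + s * y))
      + c * ((r * x + s * y) * (r * x + s * y))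
  lemma = solve-∀

record 𝒬 (d : ℤ) (Q : Form) : Set where
  open Form Q
  field
    isPrimitive      : gcd (gcd a b) c ≡ 1ℤ
    positiveDefinite : ∀ x y → ¬ (x ≡ 0ℤ × y ≡ 0ℤ) → 0ℤ < eval Q x y
    discriminant     : b * b - + 4 * a * c ≡ d

record 𝒬[_] (N : ℕ) (d : ℤ) (Q : Form) : Set where
  field
    inQ   : 𝒬 d Q
    prime : gcd (+ N) (Form.a Q) ≡ 1ℤ

ω : ∀ {d} → Form → K d
ω (form a b _) = (fromℤ (- b) +ₖ √disc) /ₖ fromℤ (+ 2 * a)

-- [Q][Q′] = [R] in 𝒬_N(d)/∼_𝔫, whose law is transported from 𝒞(𝔫) along the
-- bijection [Q] ↦ [[ω_Q , 1]].
[_][_]≡[_]mod_ : ∀ {d} (Q Q′ R : Form) (𝔫 : Pred (K d) 0ℓ) → Set₁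
[ Q ][ Q′ ]≡[ R ]mod 𝔫 = ([ ω Q , 1ₖ ] · [ ω Q′ , 1ₖ ]) ≈ [ ω R , 1ₖ ] [mod 𝔫 ]

------------------------------------------------------------------------
-- The data of the composition

infix 4 _≡_[modℤ_]

_≡_[modℤ_] : ℤ → ℤ → ℤ → Set
x ≡ y [modℤ m ] = m ∣ x - y

-- For forms of equal discriminant b + b″ is even, so the halving is exact.
Concordant : Form → Form → Set
Concordant (form a b _) (form a″ b″ _) = gcd (gcd a a″) ((b + b″) /ℕ 2) ≡ 1ℤ

record IsMiddleCoefficient (d : ℤ) (Q Q″ : Form) (B : ℤ) : Set where
  open Form Q
  open Form Q″ renaming (a to a″; b to b″; c to c″)
  field
    B≡b  : B ≡ b [modℤ + 2 * a ]
    B≡b″ : B ≡ b″ [modℤ + 2 * a″ ]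
    B²≡d : B * B ≡ d [modℤ + 4 * (a * a″) ]

-- aa″x² + Bxy + ((B²-d)/4aa″)y², with last coefficient the quotient provided by
-- the third congruence.
composite : ∀ {d B} Q Q″ → IsMiddleCoefficient d Q Q″ B → Form
composite {B = B} Q Q″ h =
  form (Form.a Q * Form.a Q″) B (_∣_.quotient (IsMiddleCoefficient.B²≡d h))

ν₁ : ∀ {d} (Q Q″ : Form) (γ : SL₂ℤ) (B : ℤ) → K d
ν₁ Q Q″ γ B =
  (fromℤ (- B) +ₖ √disc) /ₖ (fromℤ (+ 2 * (Form.a Q * Form.a Q″)) *ₖ j γ (ω Q″))

ν₂ : ∀ {d} (Q″ : Form) (γ : SL₂ℤ) → K d
ν₂ Q″ γ = 1ₖ /ₖ j γ (ω Q″)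

-- σ ≡ [ * * ; u v ] (mod N M₂(ℤ))
LowerRow : SL₂ℤ → ℤ → ℤ → ℕ → Set
LowerRow σ u v N = r ≡ u [modℤ + N ] × s ≡ v [modℤ + N ]
  where open SL₂ℤ σ

-- Write θ for the root ω of the composite form and w, w′, w″ for those of Q, Q′, Q″.
-- Dirichlet composition gives [w,1][w″,1] = [θ,1], and w′ = γw″ gives [w′,1] = j⁻¹[w″,1]
-- with j = j(γ,w″); hence [w,1][w′,1] = j⁻¹[θ,1].  The numbers u, v are the coordinates of j
-- with respect to θ, 1.  As ω_R = σθ, also [ω_R,1] = t⁻¹[θ,1] with t = j(σ,θ), and the two
-- lattices differ by the factor ν = t/j.  Since σ has lower row (u v) mod N, t - j lies in
-- N[θ,1], so ν ∈ 1 + N[w,1][w′,1]; this product has denominator aa′, which is prime to N,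
-- and therefore ν ≡* 1.

module Submission where

open import Defs
open import Level using (0ℓ)
open import Algebra.Bundles using (CommutativeRing)
import Algebra.Solver.Ring as RingSolver
open import Algebra.Solver.Ring.AlmostCommutativeRing using (fromCommutativeRing; _-Raw-AlmostCommutative⟶_)
open import Data.Empty using (⊥)
open import Data.Integer.Base as ℤ using (ℤ; +_; -[1+_]; 0ℤ; 1ℤ; _+_; _-_; _*_; -_; _<_; _≤_; _%ℕ_; _/ℕ_; ∣_∣; +<+; -<+)
open import Data.Integer.Divisibility.Signed using (_∣_; divides; _∣?_; ∣⇒∣ᵤ; ∣ᵤ⇒∣; ∣-trans; ∣m∣n⇒∣m+n; ∣m∣n⇒∣m-n; ∣n⇒∣m*n; ∣m⇒∣m*n; ∣m+n∣m⇒∣n; ∣m+n∣n⇒∣m)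
open import Data.Integer.DivMod using (a≡a%ℕn+[a/ℕn]*n; n%ℕd<d)
open import Data.Integer.GCD using (gcd; gcd[i,j]∣i; gcd[i,j]∣j; gcd-zeroˡ)
import Data.Integer.Properties as ℤ
open import Data.Integer.Tactic.RingSolver using (solve-∀)
open import Data.List.Base using ([]; _∷_; filter)
open import Data.List.Membership.Propositional.Properties using (∈-filter⁺; ∈-filter⁻)
open import Data.List.Relation.Unary.All using (_∷_)
open import Data.List.Relation.Unary.All.Properties using (filter⁺)
open import Data.Maybe.Base using (Maybe; just; nothing)
open import Data.Nat.Base as ℕ using (ℕ; zero; suc; s≤s; z≤n)
import Data.Nat.Divisibility as ℕ
import Data.Nat.GCD as ℕ
open import Data.Nat.ListAction using (product)
open import Data.Nat.ListAction.Properties using (∈⇒∣product)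
open import Data.Nat.Primality using (Prime; euclidsLemma; ¬prime[1]; prime[2])
open import Data.Nat.Primality.Factorisation using (PrimeFactorisation; factorise; factorisationHasAllPrimeFactors)
import Data.Nat.Properties as ℕ
open import Data.Product.Base using (∃; ∃₂; _×_; _,_; proj₁; proj₂)
open import Data.Rational.Base as ℚ using (ℚ; 0ℚ; 1ℚ; toℚᵘ)
import Data.Rational.Properties as ℚ
open import Data.Rational.Solver using (module +-*-Solver)
import Data.Rational.Unnormalised.Base as ℚᵘ
import Data.Rational.Unnormalised.Properties as ℚᵘ
open import Data.Sum.Base using (_⊎_; inj₁; inj₂; [_,_]′)
open import Data.Vec.Base as Vec using (Vec; []; _∷_; map; lookup; allFin)
open import Data.Vec.N-ary using (N-ary; _$ⁿ_)
open import Data.Vec.Properties using (lookup-map)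
open import Relation.Binary.Definitions using (tri<; tri≈; tri>)
open import Relation.Binary.PropositionalEquality hiding ([_])
open import Relation.Nullary using (¬_; Dec; yes; no; contradiction)
open import Relation.Nullary.Decidable using (¬?; _×-dec_)
open import Relation.Unary using (Pred; Decidable; _∈_; _⊆_; _≐_)

open import Algebra.Properties.Semiring.Exp ℤ.+-*-semiring using () renaming (_^_ to _^ℤ_)

-- What remains is why `σ` exists and why the new form lies in 𝒬_N. Both rest on explicit
-- coordinates: writing `B = b″ + 2a″e`, the lower row is `u = ra`, `v = re + s`, with `r`, `s` from
-- `γ`. Modulo `N` the factor `a` is a unit, so `(u, v)` inherits unimodularity from `γ` and lifts
-- to SL₂(ℤ). At `(v, -u)` the composite form takes the value `aa″` times the norm of `j`, which is
-- `aa′`. Modulo `N` this pair is the first column of `σ⁻¹`, so the new leading coefficient is `aa′`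
-- modulo `N`, hence prime to `N`. Primitivity is not followed through the composition: a
-- fundamental discriminant forces it on every form of that discriminant. Division in K is total,
-- with 1/0 = 0. Identities with denominators are therefore multiplied out by factors proved
-- nonzero, and the ring solver then checks them as explicit linear combinations of the hypotheses.

-- Feeds a hypothesis l ≡ r to the ring solver: x - y is exhibited as the multiple α(l - r).
lin : ∀ {x y} α {l r} → l ≡ r → x ≡ y + α * (l - r) → x ≡ y
lin {x} {y} α {l} refl eq = trans eq (identity y α l)
  where
  identity : ∀ y α l → y + α * (l - l) ≡ y
  identity = solve-∀

-- Order and cancellation in ℤ

0<⇒≢0 : ∀ {i} → 0ℤ < i → ¬ i ≡ 0ℤ
0<⇒≢0 (+<+ ()) refl

*-pos : ∀ {i j} → 0ℤ < i → 0ℤ < j → 0ℤ < i * j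
*-pos {+ suc m} {+ suc n} _ _ = +<+ (s≤s z≤n)
*-pos {+ 0} (+<+ ()) _
*-pos {+ suc m} {+ 0} _ (+<+ ())

*-pos-cancelˡ : ∀ {k i} → 0ℤ < k → 0ℤ < k * i → 0ℤ < i
*-pos-cancelˡ {+ suc m} {+ suc n} _ _ = +<+ (s≤s z≤n)
*-pos-cancelˡ {+ suc m} {+ 0} _ 0<k*0 = contradiction (ℤ.*-zeroʳ (+ suc m)) (0<⇒≢0 0<k*0)
*-pos-cancelˡ {+ suc m} { -[1+ n ]} _ ()
*-pos-cancelˡ {+ 0} (+<+ ()) _

*-≢0-cancelˡ : ∀ k {i j} → ¬ k ≡ 0ℤ → k * i ≡ k * j → i ≡ j
*-≢0-cancelˡ k {i} {j} k≢0 = ℤ.*-cancelˡ-≡ k i j {{ℤ.≢-nonZero k≢0}}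

square-pos : ∀ {i} → ¬ i ≡ 0ℤ → 0ℤ < i * i
square-pos {+ 0} i≢0 = contradiction refl i≢0
square-pos {+ suc n} _ = +<+ (s≤s z≤n)
square-pos { -[1+ n ]} _ = +<+ (s≤s z≤n)

square-nonneg : ∀ i → 0ℤ ≤ i * i
square-nonneg i with i ℤ.≟ 0ℤ
... | yes refl = ℤ.≤-refl
... | no i≢0   = ℤ.<⇒≤ (square-pos i≢0)

-- Division with remainder

%-unique-≤ : ∀ {r r′} n q q′ → r ℕ.≤ r′ → r′ ℕ.< n → + r + q * + n ≡ + r′ + q′ * + n → r ≡ r′
%-unique-≤ {r} {r′} n q q′ r≤r′ r′<n eq = sym (ℕ.≤-antisym (ℕ.m∸n≡0⇒m≤n r′∸r≡0) r≤r′)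
  where
  k = r′ ℕ.∸ r
  identity : ∀ r k q q′ n → k ≡ (q - q′) * n + 1ℤ * ((r + k + q′ * n) - (r + q * n))
  identity = solve-∀
  +k≡ : + k ≡ (q - q′) * + n
  +k≡ = lin 1ℤ (trans (cong (λ z → z + q′ * + n) (trans (sym (ℤ.pos-+ r k)) (cong +_ (ℕ.m+[n∸m]≡n r≤r′)))) (sym eq))
          (identity (+ r) (+ k) q q′ (+ n))
  n∣k : n ℕ.∣ k
  n∣k = ∣⇒∣ᵤ (divides (q - q′) +k≡)
  r′∸r≡0 : k ≡ 0
  r′∸r≡0 with k in k-eq
  ... | 0     = refl
  ... | suc _ = contradiction (subst (n ℕ.∣_) k-eq n∣k)
                  (ℕ.>⇒∤ (ℕ.≤-<-trans (ℕ.≤-reflexive (sym k-eq)) (ℕ.≤-<-trans (ℕ.m∸n≤m r′ r) r′<n)))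

%-unique : ∀ {r r′} n q q′ → r ℕ.< n → r′ ℕ.< n → + r + q * + n ≡ + r′ + q′ * + n → r ≡ r′
%-unique {r} {r′} n q q′ r<n r′<n eq with ℕ.≤-total r r′
... | inj₁ r≤r′ = %-unique-≤ n q q′ r≤r′ r′<n eq
... | inj₂ r′≤r = sym (%-unique-≤ n q′ q r′≤r r<n (sym eq))

even-or-odd : ∀ z → ∃ λ k → z ≡ + 2 * k ⊎ z ≡ + 2 * k + 1ℤ
even-or-odd z with z %ℕ 2 | n%ℕd<d z 2 | a≡a%ℕn+[a/ℕn]*n z 2
... | 0 | _ | eq = z /ℕ 2 , inj₁ (trans eq (identity (z /ℕ 2)))
  where
  identity : ∀ k → 0ℤ + k * + 2 ≡ + 2 * k
  identity = solve-∀
... | 1 | _ | eq = z /ℕ 2 , inj₂ (trans eq (identity (z /ℕ 2)))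
  where
  identity : ∀ k → 1ℤ + k * + 2 ≡ + 2 * k + 1ℤ
  identity = solve-∀
... | suc (suc _) | s≤s (s≤s ()) | _

[2*h]/2 : ∀ {z} h → z ≡ + 2 * h → z /ℕ 2 ≡ h
[2*h]/2 {z} h z≡2h = *-≢0-cancelˡ (+ 2) (λ ()) (lin 1ℤ (trans (sym split) z≡2h) (identity (z /ℕ 2) h))
  where
  identity : ∀ q h → + 2 * q ≡ + 2 * h + 1ℤ * ((0ℤ + q * + 2) - + 2 * h)
  identity = solve-∀
  identity′ : ∀ h → + 2 * h ≡ 0ℤ + h * + 2
  identity′ = solve-∀
  r≡0 : z %ℕ 2 ≡ 0
  r≡0 = %-unique 2 (z /ℕ 2) h (n%ℕd<d z 2) (s≤s z≤n)
          (trans (sym (a≡a%ℕn+[a/ℕn]*n z 2)) (trans z≡2h (identity′ h)))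
  split : z ≡ 0ℤ + (z /ℕ 2) * + 2
  split = trans (a≡a%ℕn+[a/ℕn]*n z 2) (cong (λ r → + r + (z /ℕ 2) * + 2) r≡0)

[1+4*k]%4 : ∀ {z} k → z ≡ 1ℤ + k * + 4 → z %ℕ 4 ≡ 1
[1+4*k]%4 {z} k eq = %-unique 4 (z /ℕ 4) k (n%ℕd<d z 4) (s≤s (s≤s z≤n))
  (trans (sym (a≡a%ℕn+[a/ℕn]*n z 4)) eq)

-- Bézout identities and primes

abstract
  -- The identity over ℕ comes in two subtraction-free shapes. The factors `e` and `f` with
  -- `∣x∣ = ex` and `∣y∣ = fy` restore the signs.
  bezout : ∀ x y → ∃₂ λ m n → m * x + n * y ≡ gcd x y
  bezout x y = solve-signs (abs-multiple x) (abs-multiple y) (ℕ.Bézout.identity (ℕ.gcd-GCD ∣ x ∣ ∣ y ∣))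
    where
    abs-multiple : ∀ i → ∃ λ e → + ∣ i ∣ ≡ e * i
    abs-multiple (+ n)     = 1ℤ , sym (ℤ.*-identityˡ (+ n))
    abs-multiple -[1+ n ]  = - 1ℤ , identity -[1+ n ]
      where
      identity : ∀ z → - z ≡ (- 1ℤ) * z
      identity = solve-∀
    pos-identity : ∀ g u m v n → g ℕ.+ u ℕ.* m ≡ v ℕ.* n → + g + + u * + m ≡ + v * + n
    pos-identity g u m v n eq = trans (cong (λ z → + g + z) (sym (ℤ.pos-* u m)))
      (trans (sym (ℤ.pos-+ g (u ℕ.* m))) (trans (cong +_ eq) (ℤ.pos-* v n)))
    identity : ∀ u v e f x y g → u * e * x + (- v) * f * y ≡ g + 1ℤ * (u * (e * x) - (g + v * (f * y)))
    identity = solve-∀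
    identity′ : ∀ u v e f x y g → (- v) * e * x + u * f * y ≡ g + 1ℤ * (u * (f * y) - (g + v * (e * x)))
    identity′ = solve-∀
    solve-signs : (∃ λ e → + ∣ x ∣ ≡ e * x) → (∃ λ f → + ∣ y ∣ ≡ f * y) →
      ℕ.Bézout.Identity (ℕ.gcd ∣ x ∣ ∣ y ∣) ∣ x ∣ ∣ y ∣ → ∃₂ λ m n → m * x + n * y ≡ gcd x y
    solve-signs (e , ∣x∣≡ex) (f , ∣y∣≡fy) (ℕ.Bézout.+- u v eq) = + u * e , (- + v) * f ,
      lin 1ℤ (sym (subst₂ (λ X Y → gcd x y + + v * Y ≡ + u * X) ∣x∣≡ex ∣y∣≡fy
        (pos-identity (ℕ.gcd ∣ x ∣ ∣ y ∣) v (∣ y ∣) u (∣ x ∣) eq)))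
        (identity (+ u) (+ v) e f x y (gcd x y))
    solve-signs (e , ∣x∣≡ex) (f , ∣y∣≡fy) (ℕ.Bézout.-+ v u eq) = (- + v) * e , + u * f ,
      lin 1ℤ (sym (subst₂ (λ X Y → gcd x y + + v * X ≡ + u * Y) ∣x∣≡ex ∣y∣≡fy
        (pos-identity (ℕ.gcd ∣ x ∣ ∣ y ∣) v (∣ x ∣) u (∣ y ∣) eq)))
        (identity′ (+ u) (+ v) e f x y (gcd x y))

gcd≡1⇒bezout : ∀ x y → gcd x y ≡ 1ℤ → ∃₂ λ m n → m * x + n * y ≡ 1ℤ
gcd≡1⇒bezout x y gcd≡1 = let m , n , eq = bezout x y in m , n , trans eq gcd≡1

gcd₃≡1⇒bezout : ∀ x y z → gcd (gcd x y) z ≡ 1ℤ → ∃ λ l → ∃₂ λ m n → l * x + m * y + n * z ≡ 1ℤ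
gcd₃≡1⇒bezout x y z gcd≡1 =
  let m , n , eq = bezout x y
      k , l , eq′ = gcd≡1⇒bezout (gcd x y) z gcd≡1
  in k * m , k * n , l , lin k eq (trans (identity k m n l x y z (gcd x y)) (cong (_+ k * (m * x + n * y - gcd x y)) eq′))
  where
  identity : ∀ k m n l x y z g → k * m * x + k * n * y + l * z ≡ k * g + l * z + k * (m * x + n * y - g)
  identity = solve-∀

bezout⇒gcd≡1 : ∀ {x y} m n → m * x + n * y ≡ 1ℤ → gcd x y ≡ 1ℤ
bezout⇒gcd≡1 {x} {y} m n eq = cong +_ (ℕ.∣1⇒≡1 (∣⇒∣ᵤ (subst (gcd x y ∣_) eq
  (∣m∣n⇒∣m+n (∣n⇒∣m*n m (∣ᵤ⇒∣ (gcd[i,j]∣i x y))) (∣n⇒∣m*n n (∣ᵤ⇒∣ (gcd[i,j]∣j x y)))))))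

prime∤1 : ∀ {p} → Prime p → ¬ + p ∣ 1ℤ
prime∤1 p-prime p∣1 with ℕ.∣1⇒≡1 (∣⇒∣ᵤ p∣1)
... | refl = ¬prime[1] p-prime

euclid : ∀ {p} → Prime p → ∀ x y → + p ∣ x * y → (+ p ∣ x) ⊎ (+ p ∣ y)
euclid {p} p-prime x y p∣xy with euclidsLemma ∣ x ∣ ∣ y ∣ p-prime (subst (p ℕ.∣_) (ℤ.abs-* x y) (∣⇒∣ᵤ p∣xy))
... | inj₁ p∣x = inj₁ (∣ᵤ⇒∣ p∣x)
... | inj₂ p∣y = inj₂ (∣ᵤ⇒∣ p∣y)

euclid-square : ∀ {p} → Prime p → ∀ x → + p ∣ x * x → + p ∣ x
euclid-square p-prime x p∣xx with euclid p-prime x x p∣xx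
... | inj₁ p∣x = p∣x
... | inj₂ p∣x = p∣x

prime-divisor : ∀ n .{{_ : ℕ.NonZero n}} → ¬ n ≡ 1 → ∃ λ p → Prime p × p ℕ.∣ n
prime-divisor n n≢1 with factorise n
... | record { factors = [] ; isFactorisation = n≡1 } = contradiction n≡1 n≢1
... | record { factors = p ∷ ps ; isFactorisation = eq ; factorsPrime = p-prime ∷ _ } =
      p , p-prime , subst (p ℕ.∣_) (sym eq) (ℕ.m∣m*n (product ps))

abstract
  coprime⇒bezout : ∀ x y → (∀ {p} → Prime p → + p ∣ x → + p ∣ y → ⊥) → ∃₂ λ m n → m * x + n * y ≡ 1ℤ
  coprime⇒bezout x y coprime = gcd≡1⇒bezout x y (cong +_ (gcd≡1 _ refl))
    where
    gcd≡1 : ∀ g → g ≡ ℕ.gcd ∣ x ∣ ∣ y ∣ → ℕ.gcd ∣ x ∣ ∣ y ∣ ≡ 1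
    gcd≡1 g refl with g in g-eq
    -- A zero gcd means that both numbers vanish, and then 2 is a common prime divisor.
    ... | 0 = contradiction (p∣ y (ℕ.gcd[m,n]≡0⇒n≡0 ∣ x ∣ g-eq)) (coprime prime[2] (p∣ x (ℕ.gcd[m,n]≡0⇒m≡0 g-eq)))
      where
      p∣ : ∀ z → ∣ z ∣ ≡ 0 → + 2 ∣ z
      p∣ z eq = ∣ᵤ⇒∣ (subst (2 ℕ.∣_) (sym eq) (2 ℕ.∣0))
    ... | 1 = refl
    ... | g@(suc (suc _)) = let p , p-prime , p∣g = prime-divisor g (λ ()) in
          contradiction (∣ᵤ⇒∣ (ℕ.∣-trans (subst (p ℕ.∣_) (sym g-eq) p∣g) (ℕ.gcd[m,n]∣n ∣ x ∣ ∣ y ∣)))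
            (coprime p-prime (∣ᵤ⇒∣ (ℕ.∣-trans (subst (p ℕ.∣_) (sym g-eq) p∣g) (ℕ.gcd[m,n]∣m ∣ x ∣ ∣ y ∣))))

-- Stands in for the Chinese remainder theorem: a number is built by prescribing at which primes of
-- `k` it vanishes and at which it is a unit.
record PrimePart (k : ℤ) (P : Pred ℕ _) : Set where
  field
    part     : ℤ
    sound    : ∀ {p} → Prime p → + p ∣ part → P p
    complete : ∀ {p} → Prime p → + p ∣ k → P p → + p ∣ part

abstract
  primePart : ∀ {k} → ¬ k ≡ 0ℤ → {P : Pred ℕ _} → Decidable P → PrimePart k P
  primePart {k} k≢0 {P} P? = record
    { part = + product (filter P? ps)
    ; sound = λ p-prime p∣part → proj₂ (∈-filter⁻ P? {xs = ps}
        (factorisationHasAllPrimeFactors p-prime (∣⇒∣ᵤ p∣part) (filter⁺ P? factorsPrime)))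
    ; complete = λ p-prime p∣k Pp → ∣ᵤ⇒∣ (∈⇒∣product (∈-filter⁺ P?
        (factorisationHasAllPrimeFactors p-prime (subst (_ ℕ.∣_) isFactorisation (∣⇒∣ᵤ p∣k)) factorsPrime) Pp))
    }
    where
    open PrimeFactorisation (factorise ∣ k ∣ {{ℕ.≢-nonZero (λ eq → k≢0 (ℤ.∣i∣≡0⇒i≡0 eq))}}) renaming (factors to ps)

-- ℤ/k has stable range 1.
abstract
  stable-range : ∀ x y {k} → ¬ k ≡ 0ℤ → (∀ {p} → Prime p → + p ∣ x → + p ∣ y → + p ∣ k → ⊥) →
    ∃ λ t → ∃₂ λ m n → m * (x + t * y) + n * k ≡ 1ℤ
  stable-range x y {k} k≢0 coprime = t , coprime⇒bezout (x + t * y) k no-prime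
    where
    -- `t` collects the primes of `k` that do not divide `x`. Modulo each prime of `k`, exactly one
    -- of `x` and `ty` then vanishes.
    open PrimePart (primePart k≢0 (λ p → ¬? (+ p ∣? x))) renaming (part to t)
    no-prime : ∀ {p} → Prime p → + p ∣ x + t * y → + p ∣ k → ⊥
    no-prime {p} p-prime p∣x+ty p∣k with + p ∣? x
    ... | no p∤x = p∤x (∣m+n∣n⇒∣m p∣x+ty (∣m⇒∣m*n y (complete p-prime p∣k p∤x)))
    ... | yes p∣x with euclid p-prime t y (∣m+n∣m⇒∣n p∣x+ty p∣x)
    ...   | inj₁ p∣t = sound p-prime p∣t p∣x
    ...   | inj₂ p∣y = coprime p-prime p∣x p∣y p∣k

-- Binary quadratic forms

disc : Form → ℤ
disc (form a b c) = b * b - + 4 * a * c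

disc-^ : ∀ Q γ → disc (Q ^ γ) ≡ disc Q
disc-^ Q@(form a b c) (mkSL₂ p q r s det) = lin (disc Q * (p * s - q * r + 1ℤ)) det (identity a b c p q r s)
  where
  identity : ∀ a b c p q r s →
    (+ 2 * a * (p * q) + b * (p * s + q * r) + + 2 * c * (r * s)) * (+ 2 * a * (p * q) + b * (p * s + q * r) + + 2 * c * (r * s))
      - + 4 * (a * (p * p) + b * (p * r) + c * (r * r)) * (a * (q * q) + b * (q * s) + c * (s * s))
    ≡ b * b - + 4 * a * c + (b * b - + 4 * a * c) * (p * s - q * r + 1ℤ) * (p * s - q * r - 1ℤ)
  identity = solve-∀

-- (s , -r) is the first column of γ⁻¹.
eval-^-inverse : ∀ Q γ → let open SL₂ℤ γ in eval (Q ^ γ) s (- r) ≡ Form.a Q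
eval-^-inverse Q@(form a b c) γ@(mkSL₂ p q r s det) =
  trans (eval-action Q γ s (- r))
    (trans (cong₂ (eval Q) (trans (identity p q r s) det) (identity′ r s)) (identity″ a b c))
  where
  identity : ∀ p q r s → p * s + q * (- r) ≡ p * s - q * r
  identity = solve-∀
  identity′ : ∀ r s → r * s + s * (- r) ≡ 0ℤ
  identity′ = solve-∀
  identity″ : ∀ a b c → a * (1ℤ * 1ℤ) + b * (1ℤ * 0ℤ) + c * (0ℤ * 0ℤ) ≡ a
  identity″ = solve-∀

PositiveDefinite : Form → Set
PositiveDefinite Q = ∀ x y → ¬ (x ≡ 0ℤ × y ≡ 0ℤ) → 0ℤ < eval Q x y

leading-positive : ∀ Q → PositiveDefinite Q → 0ℤ < Form.a Q
leading-positive (form a b c) Q>0 = subst (0ℤ <_) (identity a b c) (Q>0 1ℤ 0ℤ (λ { (() , _) }))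
  where
  identity : ∀ a b c → a * (1ℤ * 1ℤ) + b * (1ℤ * 0ℤ) + c * (0ℤ * 0ℤ) ≡ a
  identity = solve-∀

positiveDefinite : ∀ Q → 0ℤ < Form.a Q → disc Q < 0ℤ → PositiveDefinite Q
positiveDefinite Q@(form a b c) 0<a D<0 x y xy≢0 with y ℤ.≟ 0ℤ
... | yes refl = subst (0ℤ <_) (identity a b c x) (*-pos 0<a (square-pos (λ x≡0 → xy≢0 (x≡0 , refl))))
  where
  identity : ∀ a b c x → a * (x * x) ≡ a * (x * x) + b * (x * 0ℤ) + c * (0ℤ * 0ℤ)
  identity = solve-∀
... | no y≢0 = *-pos-cancelˡ (*-pos {+ 4} (+<+ (s≤s z≤n)) 0<a) (subst (0ℤ <_) (identity a b c x y)
      (ℤ.+-mono-≤-< (square-nonneg (+ 2 * a * x + b * y)) (*-pos (ℤ.neg-mono-< D<0) (square-pos y≢0))))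
  where
  identity : ∀ a b c x y → (+ 2 * a * x + b * y) * (+ 2 * a * x + b * y) + (- (b * b - + 4 * a * c)) * (y * y)
    ≡ + 4 * a * (a * (x * x) + b * (x * y) + c * (y * y))
  identity = solve-∀

positiveDefinite-^ : ∀ {Q} γ → PositiveDefinite Q → PositiveDefinite (Q ^ γ)
positiveDefinite-^ {Q} γ@(mkSL₂ p q r s det) Q>0 x y xy≢0 = subst (0ℤ <_) (sym (eval-action Q γ x y))
  (Q>0 (p * x + q * y) (r * x + s * y) λ { (X≡0 , Y≡0) → xy≢0
    ( lin (- x) det (lin s X≡0 (lin (- q) Y≡0 (identity p q r s x y)))
    , lin (- y) det (lin (- r) X≡0 (lin p Y≡0 (identity′ p q r s x y)))) })
  where
  identity : ∀ p q r s x y → x ≡ 0ℤ + (- x) * (p * s - q * r - 1ℤ) + s * (p * x + q * y - 0ℤ) + (- q) * (r * x + s * y - 0ℤ)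
  identity = solve-∀
  identity′ : ∀ p q r s x y → y ≡ 0ℤ + (- y) * (p * s - q * r - 1ℤ) + (- r) * (p * x + q * y - 0ℤ) + p * (r * x + s * y - 0ℤ)
  identity′ = solve-∀

-- Fundamental discriminants

disc-negative : ∀ {d} → IsImaginaryQuadraticDiscriminant d → d < 0ℤ
disc-negative record { negative = m<0 ; value = inj₁ (_ , refl) } = m<0
disc-negative record { negative = m<0 ; value = inj₂ (_ , refl) } = ℤ.*-monoˡ-<-pos (+ 4) m<0

squareFree-divisor : ∀ {m} → SquareFree m → ∀ g x → m ≡ x * (+ g * + g) → g ≡ 1
squareFree-divisor sf g x refl = sf g (ℕ.divides ∣ x ∣ (trans (ℤ.abs-* x (+ g * + g)) (cong (∣ x ∣ ℕ.*_) (ℤ.abs-* (+ g) (+ g)))))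

-- A common factor `g` gives `d = g²D` with `D = b² - 4ac`. If `d = m`, squarefreeness ends the
-- proof. If `d = 4m` and `g = 2h`, then `m = Dh²`: an even `b` makes `m` divisible by 4, and an odd
-- `b` forces `h² = 1` and `m = D ≡ 1` modulo 4, which this case of the discriminant excludes.
primitive-of-fundamental : ∀ {d} → IsImaginaryQuadraticDiscriminant d → ∀ g a b c →
  disc (form (a * + g) (b * + g) (c * + g)) ≡ d → g ≡ 1
primitive-of-fundamental record { squareFree = sf ; value = inj₁ (_ , refl) } g a b c eq =
  squareFree-divisor sf g (b * b - + 4 * a * c) (trans (sym eq) (identity a b c (+ g)))
  where
  identity : ∀ a b c g → (b * g) * (b * g) - + 4 * (a * g) * (c * g) ≡ (b * b - + 4 * a * c) * (g * g)
  identity = solve-∀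
primitive-of-fundamental record { radicand = m ; squareFree = sf ; value = inj₂ (m%4≢1 , refl) } g a b c eq
  with even-or-odd (+ g)
-- Here `g² = 4t + 1`, so `m = g²m - 4tm = g²(m - tD)`.
... | h , inj₂ g≡2h+1 = squareFree-divisor sf g (m - t * D)
        (lin (- t) (sym eq) (lin (m * (+ 2 * h + 1ℤ + + g)) (sym g≡2h+1) (identity a b c (+ g) h m)))
  where
  t = h * h + h
  D = b * b - + 4 * a * c
  identity : ∀ a b c g h m → m ≡ (m - (h * h + h) * (b * b - + 4 * a * c)) * (g * g)
    + (- (h * h + h)) * (+ 4 * m - ((b * g) * (b * g) - + 4 * (a * g) * (c * g)))
    + m * (+ 2 * h + 1ℤ + g) * (+ 2 * h + 1ℤ - g)
  identity = solve-∀
... | h , inj₁ g≡2h with even-or-odd b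
...   | k , inj₁ refl = contradiction (sf 2 (ℕ.divides ∣ X ∣ (trans (cong ∣_∣ m≡) (ℤ.abs-* X (+ 4))))) λ ()
  where
  X = (k * k - a * c) * (h * h)
  identity : ∀ a k c g h m → + 4 * m ≡ + 4 * ((k * k - a * c) * (h * h) * + 4)
    + 1ℤ * (+ 4 * m - ((+ 2 * k * g) * (+ 2 * k * g) - + 4 * (a * g) * (c * g)))
    + ((k * k - a * c) * + 4 * (g + + 2 * h)) * (g - + 2 * h)
  identity = solve-∀
  m≡ : m ≡ X * + 4
  m≡ = *-≢0-cancelˡ (+ 4) (λ ()) (lin 1ℤ (sym eq) (lin ((k * k - a * c) * + 4 * (+ g + + 2 * h)) g≡2h (identity a k c (+ g) h m)))
...   | k , inj₂ refl = contradiction ([1+4*k]%4 (k * k + k - a * c) m≡1+4*) m%4≢1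
  where
  D = (+ 2 * k + 1ℤ) * (+ 2 * k + 1ℤ) - + 4 * a * c
  identity : ∀ a k c g h m → + 4 * m ≡ + 4 * (((+ 2 * k + 1ℤ) * (+ 2 * k + 1ℤ) - + 4 * a * c) * (h * h))
    + 1ℤ * (+ 4 * m - (((+ 2 * k + 1ℤ) * g) * ((+ 2 * k + 1ℤ) * g) - + 4 * (a * g) * (c * g)))
    + (((+ 2 * k + 1ℤ) * (+ 2 * k + 1ℤ) - + 4 * a * c) * (g + + 2 * h)) * (g - + 2 * h)
  identity = solve-∀
  m≡Dhh : m ≡ D * (h * h)
  m≡Dhh = *-≢0-cancelˡ (+ 4) (λ ()) (lin 1ℤ (sym eq) (lin (D * (+ g + + 2 * h)) g≡2h (identity a k c (+ g) h m)))
  ∣h∣*∣h∣≡h*h : ∀ h → + ∣ h ∣ * + ∣ h ∣ ≡ h * h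
  ∣h∣*∣h∣≡h*h (+ n) = refl
  ∣h∣*∣h∣≡h*h -[1+ n ] = refl
  ∣h∣≡1 : ∣ h ∣ ≡ 1
  ∣h∣≡1 = squareFree-divisor sf (∣ h ∣) D (trans m≡Dhh (cong (D *_) (sym (∣h∣*∣h∣≡h*h h))))
  hh≡1 : h * h ≡ 1ℤ
  hh≡1 = trans (sym (∣h∣*∣h∣≡h*h h)) (cong (λ n → + n * + n) ∣h∣≡1)
  identity′ : ∀ a k c h → ((+ 2 * k + 1ℤ) * (+ 2 * k + 1ℤ) - + 4 * a * c) * (h * h)
    ≡ 1ℤ + (k * k + k - a * c) * + 4 + ((+ 2 * k + 1ℤ) * (+ 2 * k + 1ℤ) - + 4 * a * c) * (h * h - 1ℤ)
  identity′ = solve-∀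
  m≡1+4* : m ≡ 1ℤ + (k * k + k - a * c) * + 4
  m≡1+4* = trans m≡Dhh (lin D hh≡1 (identity′ a k c h))

isPrimitive-of-fundamental : ∀ {d} → IsImaginaryQuadraticDiscriminant d → ∀ a b c →
  disc (form a b c) ≡ d → gcd (gcd a b) c ≡ 1ℤ
isPrimitive-of-fundamental {d} d-fund a b c disc≡d = cong +_ (g≡1 _ refl
    (∣-trans g∣ab (∣ᵤ⇒∣ (gcd[i,j]∣i a b))) (∣-trans g∣ab (∣ᵤ⇒∣ (gcd[i,j]∣j a b)))
    (∣ᵤ⇒∣ (gcd[i,j]∣j (gcd a b) c)))
  where
  g∣ab : gcd (gcd a b) c ∣ gcd a b
  g∣ab = ∣ᵤ⇒∣ (gcd[i,j]∣i (gcd a b) c)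
  g≡1 : ∀ g → + g ≡ gcd (gcd a b) c → + g ∣ a → + g ∣ b → + g ∣ c → g ≡ 1
  g≡1 g _ (divides x a≡) (divides y b≡) (divides z c≡) = primitive-of-fundamental d-fund g x y z
    (trans (cong disc (trans (cong₂ (λ A B → form A B (z * + g)) (sym a≡) (sym b≡)) (cong (form a b) (sym c≡)))) disc≡d)

-- The middle coefficient

parity : ∀ Q → ∃ λ n → disc Q + Form.b Q ≡ + 2 * n
parity (form a b c) with even-or-odd b
... | k , inj₁ refl = (+ 2 * k * k - + 2 * a * c + k) , identity a k c
  where
  identity : ∀ a k c → (+ 2 * k) * (+ 2 * k) - + 4 * a * c + + 2 * k ≡ + 2 * (+ 2 * k * k - + 2 * a * c + k)
  identity = solve-∀
... | k , inj₂ refl = (+ 2 * k * k + + 3 * k + 1ℤ - + 2 * a * c) , identity a k c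
  where
  identity : ∀ a k c → (+ 2 * k + 1ℤ) * (+ 2 * k + 1ℤ) - + 4 * a * c + (+ 2 * k + 1ℤ) ≡ + 2 * (+ 2 * k * k + + 3 * k + 1ℤ - + 2 * a * c)
  identity = solve-∀

-- Replaces the halving by an explicit `s` and the gcd condition by Bézout coefficients, the shape
-- in which the ring solver can use them.
record Composable (Q Q″ : Form) : Set where
  open Form Q
  open Form Q″ renaming (a to a″; b to b″; c to c″)
  field
    s l m n    : ℤ
    b+b″≡2s    : b + b″ ≡ + 2 * s
    bezout-aa″s : l * a + m * a″ + n * s ≡ 1ℤ

concordant⇒composable : ∀ Q Q″ → disc Q ≡ disc Q″ → Concordant Q Q″ → Composable Q Q″
concordant⇒composable Q@(form a b c) Q″@(form a″ b″ c″) D≡D″ concordant =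
  let n₁ , eq₁ = parity Q
      n₂ , eq₂ = parity Q″
      s = n₁ + n₂ - disc Q
      b+b″≡2s = lin 1ℤ eq₁ (lin 1ℤ eq₂ (lin 1ℤ D≡D″ (identity b b″ (disc Q) (disc Q″) n₁ n₂)))
      l , m , n , bez = gcd₃≡1⇒bezout a a″ s (trans (cong (gcd (gcd a a″)) (sym ([2*h]/2 s b+b″≡2s))) concordant)
  in record { s = s ; l = l ; m = m ; n = n ; b+b″≡2s = b+b″≡2s ; bezout-aa″s = bez }
  where
  identity : ∀ b b″ D D″ n₁ n₂ → b + b″ ≡ + 2 * (n₁ + n₂ - D) + 1ℤ * (D + b - + 2 * n₁) + 1ℤ * (D″ + b″ - + 2 * n₂) + 1ℤ * (D - D″)
  identity = solve-∀

module Middle {d} (Q Q″ : Form) (D≡d : disc Q ≡ d) (D″≡d : disc Q″ ≡ d) (composable : Composable Q Q″) where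
  open Form Q
  open Form Q″ renaming (a to a″; b to b″; c to c″)
  open Composable composable

  a″c″≡ : a″ * c″ ≡ a * c + s * s - s * b
  a″c″≡ = *-≢0-cancelˡ (+ 4) (λ ()) (lin 1ℤ (trans D≡d (sym D″≡d)) (lin (b″ + + 2 * s - b) b+b″≡2s (identity a b c a″ b″ c″ s)))
    where
    identity : ∀ a b c a″ b″ c″ s → + 4 * (a″ * c″) ≡ + 4 * (a * c + s * s - s * b)
      + 1ℤ * ((b * b - + 4 * a * c) - (b″ * b″ - + 4 * a″ * c″)) + (b″ + + 2 * s - b) * (b + b″ - + 2 * s)
    identity = solve-∀

  -- T = (bb″ + d)/2, so that B² - d = (B - b)(B - b″) + 2(sB - T).
  T : ℤ
  T = b * s - + 2 * a * c

  B²-d≡ : ∀ {B} X Y W → B - b ≡ X * (+ 2 * a) → B - b″ ≡ Y * (+ 2 * a″) →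
    s * B ≡ T + W * (+ 2 * (a * a″)) → B * B - d ≡ (X * Y + W) * (+ 4 * (a * a″))
  B²-d≡ {B} X Y W B-b≡ B-b″≡ sB≡ =
    lin (B - b″) B-b≡ (lin (+ 2 * a * X) B-b″≡ (lin (B - b) b+b″≡2s (lin (+ 2) sB≡ (lin 1ℤ D≡d
      (identity a b c a″ b″ d s B X Y W)))))
    where
    identity : ∀ a b c a″ b″ d s B X Y W → B * B - d ≡ (X * Y + W) * (+ 4 * (a * a″))
      + (B - b″) * (B - b - X * (+ 2 * a)) + + 2 * a * X * (B - b″ - Y * (+ 2 * a″)) + (B - b) * (b + b″ - + 2 * s)
      + + 2 * (s * B - (b * s - + 2 * a * c + W * (+ 2 * (a * a″)))) + 1ℤ * (b * b - + 4 * a * c - d)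
    identity = solve-∀

  -- The identity for `B² - d` read backwards: it turns the quadratic congruence into a linear one,
  -- as uniqueness requires.
  sB≡T : ∀ {B} X Y E → B - b ≡ X * (+ 2 * a) → B - b″ ≡ Y * (+ 2 * a″) →
    B * B - d ≡ E * (+ 4 * (a * a″)) → s * B ≡ T + (E - X * Y) * (+ 2 * (a * a″))
  sB≡T {B} X Y E B-b≡ B-b″≡ B²-d≡′ = *-≢0-cancelˡ (+ 2) (λ ())
    (lin (- (B - b″)) B-b≡ (lin (- (+ 2 * a * X)) B-b″≡ (lin (- (B - b)) b+b″≡2s (lin 1ℤ B²-d≡′ (lin (- 1ℤ) D≡d
      (identity a b c a″ b″ d s B X Y E))))))
    where
    identity : ∀ a b c a″ b″ d s B X Y E → + 2 * (s * B) ≡ + 2 * (b * s - + 2 * a * c + (E - X * Y) * (+ 2 * (a * a″)))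
      + (- (B - b″)) * (B - b - X * (+ 2 * a)) + (- (+ 2 * a * X)) * (B - b″ - Y * (+ 2 * a″)) + (- (B - b)) * (b + b″ - + 2 * s)
      + 1ℤ * (B * B - d - E * (+ 4 * (a * a″))) + (- 1ℤ) * (b * b - + 4 * a * c - d)
    identity = solve-∀

  -- All conditions become linear modulo `2aa″`: `aB ≡ ab″`, `a″B ≡ a″b` and `sB ≡ T`. Adding them
  -- with the Bézout coefficients of `a`, `a″`, `s` leaves only one candidate for `B`, Dirichlet's
  -- formula, in which `2s - b` stands for `b″`.
  exists : ∃ λ B → IsMiddleCoefficient d Q Q″ B
  exists = B , record
    { B≡b = divides X B-b≡
    ; B≡b″ = divides Y B-b″≡
    ; B²≡d = divides (X * Y + W) (B²-d≡ X Y W B-b≡ B-b″≡ sB≡)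
    }
    where
    B = l * a * (+ 2 * s - b) + m * a″ * b + n * T
    -- The quotients come from `T = sb - 2ac = sb″ - 2a″c″`, after multiplying `b`, `b″` and `T` by
    -- `la + ma″ + ns = 1`.
    X = l * (s - b) - n * c
    Y = m * (b - s) - n * c″
    W = l * c″ + m * c
    B-b≡ : B - b ≡ X * (+ 2 * a)
    B-b≡ = lin b bezout-aa″s (identity a b c a″ s l m n)
      where
      identity : ∀ a b c a″ s l m n → l * a * (+ 2 * s - b) + m * a″ * b + n * (b * s - + 2 * a * c) - b
        ≡ (l * (s - b) - n * c) * (+ 2 * a) + b * (l * a + m * a″ + n * s - 1ℤ)
      identity = solve-∀
    B-b″≡ : B - b″ ≡ Y * (+ 2 * a″)
    B-b″≡ = lin (- 1ℤ) b+b″≡2s (lin (+ 2 * s - b) bezout-aa″s (lin (+ 2 * n) a″c″≡ (identity a b c a″ b″ c″ s l m n)))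
      where
      identity : ∀ a b c a″ b″ c″ s l m n → l * a * (+ 2 * s - b) + m * a″ * b + n * (b * s - + 2 * a * c) - b″
        ≡ (m * (b - s) - n * c″) * (+ 2 * a″) + (- 1ℤ) * (b + b″ - + 2 * s) + (+ 2 * s - b) * (l * a + m * a″ + n * s - 1ℤ) + + 2 * n * (a″ * c″ - (a * c + s * s - s * b))
      identity = solve-∀
    sB≡ : s * B ≡ T + W * (+ 2 * (a * a″))
    sB≡ = lin T bezout-aa″s (lin (- (+ 2 * l * a)) a″c″≡ (identity a b c a″ c″ s l m n))
      where
      identity : ∀ a b c a″ c″ s l m n → s * (l * a * (+ 2 * s - b) + m * a″ * b + n * (b * s - + 2 * a * c))
        ≡ b * s - + 2 * a * c + (l * c″ + m * c) * (+ 2 * (a * a″)) + (b * s - + 2 * a * c) * (l * a + m * a″ + n * s - 1ℤ)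
          + (- (+ 2 * l * a)) * (a″ * c″ - (a * c + s * s - s * b))
      identity = solve-∀

  -- `B - B′` is multiplied by `la + ma″ + ns = 1`. Each of `a(B - B′)`, `a″(B - B′)` and
  -- `s(B - B′)` is a multiple of `2aa″`.
  unique : ∀ B B′ → IsMiddleCoefficient d Q Q″ B → IsMiddleCoefficient d Q Q″ B′ → B ≡ B′ [modℤ + 2 * (a * a″) ]
  unique B B′ record { B≡b = divides X B-b≡ ; B≡b″ = divides Y B-b″≡ ; B²≡d = divides E B²-d≡ }
              record { B≡b = divides X′ B′-b≡ ; B≡b″ = divides Y′ B′-b″≡ ; B²≡d = divides E′ B′²-d≡ } =
    divides (l * (Y - Y′) + m * (X - X′) + n * (W - W′))
      (lin (- (B - B′)) bezout-aa″s (lin (l * a) B-b″≡ (lin (- (l * a)) B′-b″≡ (lin (m * a″) B-b≡ (lin (- (m * a″)) B′-b≡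
        (lin n (sB≡T X Y E B-b≡ B-b″≡ B²-d≡) (lin (- n) (sB≡T X′ Y′ E′ B′-b≡ B′-b″≡ B′²-d≡)
          (identity a b a″ b″ s l m n T B B′ X X′ Y Y′ W W′))))))))
    where
    W = E - X * Y
    W′ = E′ - X′ * Y′
    identity : ∀ a b a″ b″ s l m n T B B′ X X′ Y Y′ W W′ →
      B - B′ ≡ (l * (Y - Y′) + m * (X - X′) + n * (W - W′)) * (+ 2 * (a * a″))
        + (- (B - B′)) * (l * a + m * a″ + n * s - 1ℤ)
        + l * a * (B - b″ - Y * (+ 2 * a″)) + (- (l * a)) * (B′ - b″ - Y′ * (+ 2 * a″))
        + m * a″ * (B - b - X * (+ 2 * a)) + (- (m * a″)) * (B′ - b - X′ * (+ 2 * a))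
        + n * (s * B - (T + W * (+ 2 * (a * a″)))) + (- n) * (s * B′ - (T + W′ * (+ 2 * (a * a″))))
    identity = solve-∀

-- Unimodular matrices

coprime⇒concordant : ∀ Q Q″ → gcd (Form.a Q) (Form.a Q″) ≡ 1ℤ → Concordant Q Q″
coprime⇒concordant (form a b _) (form a″ b″ _) gcd≡1 =
  trans (cong (λ g → gcd g ((b + b″) /ℕ 2)) gcd≡1) (gcd-zeroˡ ((b + b″) /ℕ 2))

-- p is made of the primes dividing a and a′ but not c′, and r of those dividing a but not a′:
-- modulo a prime divisor of a, exactly one monomial of Q′(p , r) is nonzero.
represents-coprime : ∀ a Q′ → ¬ a ≡ 0ℤ → let open Form Q′ renaming (a to a′; b to b′; c to c′) in
  gcd (gcd a′ b′) c′ ≡ 1ℤ →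
  ∃₂ λ p r → (∃₂ λ m n → m * p + n * r ≡ 1ℤ) × (∃₂ λ m n → m * a + n * eval Q′ p r ≡ 1ℤ)
represents-coprime a Q′@(form a′ b′ c′) a≢0 gcd≡1 = choose
  (primePart a≢0 (λ π → (+ π ∣? a′) ×-dec ¬? (+ π ∣? c′)))
  (primePart a≢0 (λ π → ¬? (+ π ∣? a′)))
  where
  no-common-prime : ∀ {π} → Prime π → + π ∣ a′ → + π ∣ b′ → + π ∣ c′ → ⊥
  no-common-prime {π} π-prime π∣a′ π∣b′ π∣c′ = let l , m , n , eq = gcd₃≡1⇒bezout a′ b′ c′ gcd≡1 in
    prime∤1 π-prime (subst (+ π ∣_) eq (∣m∣n⇒∣m+n (∣m∣n⇒∣m+n (∣n⇒∣m*n l π∣a′) (∣n⇒∣m*n m π∣b′)) (∣n⇒∣m*n n π∣c′)))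

  choose : PrimePart a (λ π → (+ π ∣ a′) × ¬ + π ∣ c′) → PrimePart a (λ π → ¬ + π ∣ a′) → _
  choose record { part = p ; sound = p-sound ; complete = p-complete }
         record { part = r ; sound = r-sound ; complete = r-complete } =
    p , r , coprime⇒bezout p r p⊥r , coprime⇒bezout a (eval Q′ p r) a⊥f
    where
    p⊥r : ∀ {π} → Prime π → + π ∣ p → + π ∣ r → ⊥
    p⊥r π-prime π∣p π∣r = r-sound π-prime π∣r (proj₁ (p-sound π-prime π∣p))

    a⊥f : ∀ {π} → Prime π → + π ∣ a → + π ∣ eval Q′ p r → ⊥
    a⊥f {π} π-prime π∣a π∣f = cases (+ π ∣? a′) (+ π ∣? c′)
      where
      cases : Dec (+ π ∣ a′) → Dec (+ π ∣ c′) → ⊥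
      cases (no π∤a′) _ =
        [ π∤a′ , (λ π∣pp → p⊥r π-prime (euclid-square π-prime p π∣pp) π∣r) ]′ (euclid π-prime a′ (p * p)
          (∣m+n∣n⇒∣m (∣m+n∣n⇒∣m π∣f (∣n⇒∣m*n c′ (∣n⇒∣m*n r π∣r))) (∣n⇒∣m*n b′ (∣n⇒∣m*n p π∣r))))
        where π∣r = r-complete π-prime π∣a π∤a′
      cases (yes π∣a′) (no π∤c′) =
        [ π∤c′ , (λ π∣rr → p⊥r π-prime π∣p (euclid-square π-prime r π∣rr)) ]′ (euclid π-prime c′ (r * r)
          (∣m+n∣m⇒∣n π∣f (∣m∣n⇒∣m+n (∣m⇒∣m*n (p * p) π∣a′) (∣n⇒∣m*n b′ (∣m⇒∣m*n r π∣p)))))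
        where π∣p = p-complete π-prime π∣a (π∣a′ , π∤c′)
      cases (yes π∣a′) (yes π∣c′) =
        [ (λ π∣b′ → no-common-prime π-prime π∣a′ π∣b′ π∣c′)
        , (λ π∣pr → [ (λ π∣p → proj₂ (p-sound π-prime π∣p) π∣c′) , (λ π∣r → r-sound π-prime π∣r π∣a′) ]′
            (euclid π-prime p r π∣pr)) ]′ (euclid π-prime b′ (p * r)
          (∣m+n∣m⇒∣n (∣m+n∣n⇒∣m π∣f (∣m⇒∣m*n (r * r) π∣c′)) (∣m⇒∣m*n (p * p) π∣a′)))

concordant-translate : ∀ Q Q′ → ¬ Form.a Q ≡ 0ℤ →
  gcd (gcd (Form.a Q′) (Form.b Q′)) (Form.c Q′) ≡ 1ℤ → ∃ λ γ → Concordant Q (Q′ ^ γ)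
concordant-translate Q Q′ a≢0 gcd≡1 =
  let p , r , (m , n , eq) , (x , y , eq′) = represents-coprime (Form.a Q) Q′ a≢0 gcd≡1
      -- The first column `(p , r)` makes `Q′(p , r)` the new leading coefficient. It is coprime to
      -- `a` by itself, which is stronger than concordance.
      γ = mkSL₂ p (- n) r m (trans (identity p r m n) eq)
  in γ , coprime⇒concordant Q (Q′ ^ γ) (bezout⇒gcd≡1 x y eq′)
  where
  identity : ∀ p r m n → p * m - (- n) * r ≡ m * p + n * r
  identity = solve-∀

-- With `s ≡ v` fixed, stable range modulo `s` moves `u` within its class modulo `N` until it is
-- coprime to `s`. A Bézout relation then supplies the upper row.
lift-lower-row : ∀ u v N → 0 ℕ.< N → ∃ (λ l → ∃₂ λ m n → l * u + m * v + n * + N ≡ 1ℤ) → ∃ λ σ → LowerRow σ u v N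
lift-lower-row u v N 0<N (l , m , n , bez) =
  let s , s≢0 , N∣s-v = nonzero-lift
      t , x , y , eq = stable-range u (+ N) s≢0 (λ π-prime π∣u π∣N π∣s → prime∤1 π-prime (subst (_ ∣_) bez
        (∣m∣n⇒∣m+n (∣m∣n⇒∣m+n (∣n⇒∣m*n l π∣u) (∣n⇒∣m*n m (π∣v π∣s (∣-trans π∣N N∣s-v)))) (∣n⇒∣m*n n π∣N))))
  in mkSL₂ y (- x) (u + t * + N) s (trans (identity x y (u + t * + N) s) eq)
   , divides t (identity′ u (t * + N)) , N∣s-v
  where
  identity : ∀ x y r s → y * s - (- x) * r ≡ x * r + y * s
  identity = solve-∀
  identity′ : ∀ u z → u + z - u ≡ z
  identity′ = solve-∀
  identity″ : ∀ s v → s - (s - v) ≡ v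
  identity″ = solve-∀
  nonzero-lift : ∃ λ s → (¬ s ≡ 0ℤ) × (s ≡ v [modℤ + N ])
  nonzero-lift with v ℤ.≟ 0ℤ
  ... | no v≢0   = v , v≢0 , divides 0ℤ (ℤ.+-inverseʳ v)
  -- Stable range requires a nonzero modulus, so `0` is replaced by `N` in its class.
  ... | yes refl = + N , 0<⇒≢0 (+<+ 0<N) , divides 1ℤ (trans (ℤ.+-identityʳ (+ N)) (sym (ℤ.*-identityˡ (+ N))))
  π∣v : ∀ {π s} → + π ∣ s → + π ∣ s - v → + π ∣ v
  π∣v {s = s} π∣s π∣s-v = subst (_ ∣_) (identity″ s v) (∣m∣n⇒∣m-n π∣s π∣s-v)

-- The lower row (u , v)

module LowerRowCoefficients {d N} (Q Q′ : Form) (γ : SL₂ℤ) (B e E : ℤ) (D″≡d : disc (Q′ ^ γ) ≡ d)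
    (a″≢0 : ¬ Form.a (Q′ ^ γ) ≡ 0ℤ)
    (B-b″≡ : B - Form.b (Q′ ^ γ) ≡ e * (+ 2 * Form.a (Q′ ^ γ)))
    (B²-d≡ : B * B - d ≡ E * (+ 4 * (Form.a Q * Form.a (Q′ ^ γ))))
    (prime : gcd (+ N) (Form.a Q) ≡ 1ℤ) (prime′ : gcd (+ N) (Form.a Q′) ≡ 1ℤ) where
  open Form Q
  open Form Q′ using () renaming (a to a′)
  open Form (Q′ ^ γ) renaming (a to a″; b to b″; c to c″)
  open SL₂ℤ γ

  u v : ℤ
  u = r * a
  v = r * e + s

  -- `(r , re + s)` is the lower row of `γ` times a translation, so `p(re + s) - (pe + q)r = 1`.
  -- Passing from `r` to `u = ra` is harmless because `x` inverts `a` modulo `N`.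
  bezout-uvN : ∃ λ l → ∃₂ λ m n → l * u + m * v + n * + N ≡ 1ℤ
  bezout-uvN = let y , x , eq = gcd≡1⇒bezout (+ N) a prime in
    - (p * e + q) * x , p , - (p * e + q) * y * r , lin (- (p * e + q) * r) eq (lin 1ℤ det (identity p q r s a e x y (+ N)))
    where
    identity : ∀ p q r s a e x y N → - (p * e + q) * x * (r * a) + p * (r * e + s) + - (p * e + q) * y * r * N
      ≡ 1ℤ + - (p * e + q) * r * (y * N + x * a - 1ℤ) + 1ℤ * (p * s - q * r - 1ℤ)
    identity = solve-∀

  -- Translating `Q″` by `e` gives a form with coefficients `a″`, `B` and discriminant `d`. Its last
  -- coefficient is then forced to be `aE`.
  aE≡ : a * E ≡ e * b″ + a″ * (e * e) + c″
  aE≡ = *-≢0-cancelˡ a″ a″≢0 (*-≢0-cancelˡ (+ 4) (λ ())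
    (lin (- 1ℤ) B²-d≡ (lin (B + b″ + e * (+ 2 * a″)) B-b″≡ (lin 1ℤ D″≡d (identity a a″ b″ c″ d e B E)))))
    where
    identity : ∀ a a″ b″ c″ d e B E → + 4 * (a″ * (a * E)) ≡ + 4 * (a″ * (e * b″ + a″ * (e * e) + c″))
      + (- 1ℤ) * (B * B - d - E * (+ 4 * (a * a″))) + (B + b″ + e * (+ 2 * a″)) * (B - b″ - e * (+ 2 * a″))
      + 1ℤ * (b″ * b″ - + 4 * a″ * c″ - d)
    identity = solve-∀

  -- By the translation above, `C(x , ay) = a Q″(x + ey , y)` for the composite form `C`. At
  -- `x = v`, `y = -r` the right side is `a Q″(s , -r)`, and `(s , -r)` is where `Q″` takes the
  -- value `a′`.
  value : eval (form (a * a″) B E) v (- u) ≡ a * a′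
  value = lin a (eval-^-inverse Q′ γ) (lin (- (u * v)) B-b″≡ (lin (r * r * a) aE≡ (identity a a′ a″ b″ c″ e B E r s)))
    where
    identity : ∀ a a′ a″ b″ c″ e B E r s →
      a * a″ * ((r * e + s) * (r * e + s)) + B * ((r * e + s) * (- (r * a))) + E * ((- (r * a)) * (- (r * a)))
      ≡ a * a′ + a * ((a″ * (s * s) + b″ * (s * (- r)) + c″ * ((- r) * (- r))) - a′)
        + (- (r * a * (r * e + s))) * (B - b″ - e * (+ 2 * a″)) + r * r * a * (a * E - (e * b″ + a″ * (e * e) + c″))
    identity = solve-∀

  aa′-prime : ∃₂ λ m n → m * (a * a′) + n * + N ≡ 1ℤ
  aa′-prime = let y , x , eq = gcd≡1⇒bezout (+ N) a prime
                  y′ , x′ , eq′ = gcd≡1⇒bezout (+ N) a′ prime′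
              in x * x′ , y + x * a * y′ , lin 1ℤ eq (lin (x * a) eq′ (identity a a′ x y x′ y′ (+ N)))
    where
    identity : ∀ a a′ x y x′ y′ N → x * x′ * (a * a′) + (y + x * a * y′) * N
      ≡ 1ℤ + 1ℤ * (y * N + x * a - 1ℤ) + x * a * (y′ * N + x′ * a′ - 1ℤ)
    identity = solve-∀

  -- The leading coefficient is the composite form at the first column of `σ⁻¹`, which is `(v , -u)`
  -- modulo `N`. It is therefore congruent to `aa′`; `δ` is the quotient of the difference by `N`.
  value-prime : ∀ (σ : SL₂ℤ) → LowerRow σ u v N → gcd (+ N) (Form.a (form (a * a″) B E ^ (σ ⁻¹))) ≡ 1ℤ
  value-prime σ@(mkSL₂ pσ qσ rσ sσ _) (divides k rσ-u≡ , divides k′ sσ-v≡) =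
    let m , n , eq = aa′-prime
    in bezout⇒gcd≡1 (n - m * δ k k′) m
         (lin 1ℤ eq (lin m value (lin (m * α) rσ-u≡ (lin (m * β) sσ-v≡ (identity (a * a″) B E (a * a′) u v rσ sσ k k′ m n (+ N))))))
    where
    α = - (B * sσ) + E * (rσ + u)
    β = a * a″ * (sσ + v) - B * u
    δ = λ k k′ → a * a″ * (sσ + v) * k′ - B * (u * k′ + sσ * k) + E * (rσ + u) * k
    identity : ∀ A B E z u v rσ sσ k k′ m n N →
      (n - m * (A * (sσ + v) * k′ - B * (u * k′ + sσ * k) + E * (rσ + u) * k)) * N
        + m * (A * (sσ * sσ) + B * (sσ * (- rσ)) + E * ((- rσ) * (- rσ)))
      ≡ 1ℤ + 1ℤ * (m * z + n * N - 1ℤ) + m * ((A * (v * v) + B * (v * (- u)) + E * ((- u) * (- u))) - z)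
        + m * (- (B * sσ) + E * (rσ + u)) * (rσ - u - k * N) + m * (A * (sσ + v) - B * u) * (sσ - v - k′ * N)
    identity = solve-∀

-- The field K

/1-homo-+ : ∀ m n → (m + n) ℚ./ 1 ≡ m ℚ./ 1 ℚ.+ n ℚ./ 1
/1-homo-+ m n = ℚ.toℚᵘ-injective (begin
  toℚᵘ ((m + n) ℚ./ 1)                 ≈⟨ ℚ.toℚᵘ-fromℚᵘ (ℚᵘ.mkℚᵘ (m + n) 0) ⟩
  ℚᵘ.mkℚᵘ (m + n) 0                    ≈⟨ ℚᵘ.*≡* (identity m n) ⟩
  ℚᵘ.mkℚᵘ m 0 ℚᵘ.+ ℚᵘ.mkℚᵘ n 0           ≈⟨ ℚᵘ.+-cong (ℚ.toℚᵘ-fromℚᵘ (ℚᵘ.mkℚᵘ m 0)) (ℚ.toℚᵘ-fromℚᵘ (ℚᵘ.mkℚᵘ n 0)) ⟨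
  toℚᵘ (m ℚ./ 1) ℚᵘ.+ toℚᵘ (n ℚ./ 1)     ≈⟨ ℚ.toℚᵘ-homo-+ (m ℚ./ 1) (n ℚ./ 1) ⟨
  toℚᵘ (m ℚ./ 1 ℚ.+ n ℚ./ 1)             ∎)
  where
  open ℚᵘ.≃-Reasoning
  identity : ∀ m n → (m + n) * + 1 ≡ (m * + 1 + n * + 1) * + 1
  identity = solve-∀

/1-homo-* : ∀ m n → (m * n) ℚ./ 1 ≡ m ℚ./ 1 ℚ.* (n ℚ./ 1)
/1-homo-* m n = ℚ.toℚᵘ-injective (begin
  toℚᵘ ((m * n) ℚ./ 1)                 ≈⟨ ℚ.toℚᵘ-fromℚᵘ (ℚᵘ.mkℚᵘ (m * n) 0) ⟩
  ℚᵘ.mkℚᵘ m 0 ℚᵘ.* ℚᵘ.mkℚᵘ n 0           ≈⟨ ℚᵘ.*-cong (ℚ.toℚᵘ-fromℚᵘ (ℚᵘ.mkℚᵘ m 0)) (ℚ.toℚᵘ-fromℚᵘ (ℚᵘ.mkℚᵘ n 0)) ⟨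
  toℚᵘ (m ℚ./ 1) ℚᵘ.* toℚᵘ (n ℚ./ 1)     ≈⟨ ℚ.toℚᵘ-homo-* (m ℚ./ 1) (n ℚ./ 1) ⟨
  toℚᵘ (m ℚ./ 1 ℚ.* (n ℚ./ 1))             ∎)
  where open ℚᵘ.≃-Reasoning

/1-homo-neg : ∀ m → (- m) ℚ./ 1 ≡ ℚ.- (m ℚ./ 1)
/1-homo-neg m = ℚ.toℚᵘ-injective (begin
  toℚᵘ ((- m) ℚ./ 1)      ≈⟨ ℚ.toℚᵘ-fromℚᵘ (ℚᵘ.mkℚᵘ (- m) 0) ⟩
  ℚᵘ.- (ℚᵘ.mkℚᵘ m 0)        ≈⟨ ℚᵘ.-‿cong (ℚ.toℚᵘ-fromℚᵘ (ℚᵘ.mkℚᵘ m 0)) ⟨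
  ℚᵘ.- toℚᵘ (m ℚ./ 1)       ≈⟨ ℚ.toℚᵘ-homo‿- (m ℚ./ 1) ⟨
  toℚᵘ (ℚ.- (m ℚ./ 1))      ∎)
  where open ℚᵘ.≃-Reasoning

/1-injective : ∀ {m n} → m ℚ./ 1 ≡ n ℚ./ 1 → m ≡ n
/1-injective {m} {n} eq with ℚ.fromℚᵘ-injective {ℚᵘ.mkℚᵘ m 0} {ℚᵘ.mkℚᵘ n 0} eq
... | ℚᵘ.*≡* m*1≡n*1 = trans (sym (ℤ.*-identityʳ m)) (trans m*1≡n*1 (ℤ.*-identityʳ n))

square-positive : ∀ p → ¬ p ≡ 0ℚ → 0ℚ ℚ.< p ℚ.* p
square-positive p p≢0 with ℚ.<-cmp p 0ℚ
... | tri< p<0 _ _ = ℚ.positive⁻¹ _ {{ℚ.neg*neg⇒pos p {{ℚ.negative p<0}} p {{ℚ.negative p<0}}}}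
... | tri≈ _ p≡0 _ = contradiction p≡0 p≢0
... | tri> _ _ p>0 = ℚ.positive⁻¹ _ {{ℚ.pos*pos⇒pos p {{ℚ.positive p>0}} p {{ℚ.positive p>0}}}}

square-nonNegative : ∀ p → 0ℚ ℚ.≤ p ℚ.* p
square-nonNegative p with p ℚ.≟ 0ℚ
... | yes refl = ℚ.≤-refl
... | no p≢0   = ℚ.<⇒≤ (square-positive p p≢0)

*-positive : ∀ p q → 0ℚ ℚ.< p → 0ℚ ℚ.< q → 0ℚ ℚ.< p ℚ.* q
*-positive p q 0<p 0<q = ℚ.positive⁻¹ _ {{ℚ.pos*pos⇒pos p {{ℚ.positive 0<p}} q {{ℚ.positive 0<q}}}}

neg/1-positive : ∀ d → d < 0ℤ → 0ℚ ℚ.< ℚ.- (d ℚ./ 1)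
neg/1-positive -[1+ n ] -<+ = subst (0ℚ ℚ.<_) (/1-homo-neg -[1+ n ])
  (ℚ.positive⁻¹ _ {{ℚ.normalize-pos (ℕ.suc n) 1}})

module _ {d : ℤ} where

  negₖ : K d → K d
  negₖ (p +√· q) = (ℚ.- p) +√· (ℚ.- q)

  K-commutativeRing : CommutativeRing 0ℓ 0ℓ
  K-commutativeRing = record
    { Carrier = K d ; _≈_ = _≡_ ; _+_ = _+ₖ_ ; _*_ = _*ₖ_ ; -_ = negₖ ; 0# = 0ₖ ; 1# = 1ₖ
    ; isCommutativeRing = record
      { isRing = record
        { +-isAbelianGroup = record
          { isGroup = record
            { isMonoid = record
              { isSemigroup = record
                { isMagma = record { isEquivalence = isEquivalence ; ∙-cong = cong₂ _+ₖ_ }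
                ; assoc = λ { (a +√· b) (c +√· e) (f +√· g) →
                    cong₂ _+√·_ (ℚ.+-assoc a c f) (ℚ.+-assoc b e g) } }
              ; identity = (λ { (a +√· b) → cong₂ _+√·_ (ℚ.+-identityˡ a) (ℚ.+-identityˡ b) })
                         , (λ { (a +√· b) → cong₂ _+√·_ (ℚ.+-identityʳ a) (ℚ.+-identityʳ b) }) }
            ; inverse = (λ { (a +√· b) → cong₂ _+√·_ (ℚ.+-inverseˡ a) (ℚ.+-inverseˡ b) })
                      , (λ { (a +√· b) → cong₂ _+√·_ (ℚ.+-inverseʳ a) (ℚ.+-inverseʳ b) })
            ; ⁻¹-cong = cong negₖ }
          ; comm = λ { (a +√· b) (c +√· e) → cong₂ _+√·_ (ℚ.+-comm a c) (ℚ.+-comm b e) } }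
        ; *-cong = cong₂ _*ₖ_
        ; *-assoc = assoc
        ; *-identity = (λ x → trans (comm 1ₖ x) (identityʳ x)) , identityʳ
        ; distrib = distribˡ
                  , (λ x y z → trans (comm (y +ₖ z) x) (trans (distribˡ x y z)
                      (cong₂ _+ₖ_ (comm x y) (comm x z))))
        }
      ; *-comm = comm
      }
    }
    where
    open +-*-Solver
    D = d ℚ./ 1
    comm : ∀ x y → x *ₖ y ≡ y *ₖ x
    comm (a +√· b) (c +√· e) = cong₂ _+√·_
      (solve 5 (λ a b c e D → a :* c :+ D :* (b :* e) := c :* a :+ D :* (e :* b)) refl a b c e D)
      (solve 4 (λ a b c e → a :* e :+ b :* c := c :* b :+ e :* a) refl a b c e)
    identityʳ : ∀ x → x *ₖ 1ₖ ≡ x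
    identityʳ (a +√· b) = cong₂ _+√·_
      (solve 3 (λ a b D → a :* con 1ℚ :+ D :* (b :* con 0ℚ) := a) refl a b D)
      (solve 2 (λ a b → a :* con 0ℚ :+ b :* con 1ℚ := b) refl a b)
    assoc : ∀ x y z → (x *ₖ y) *ₖ z ≡ x *ₖ (y *ₖ z)
    assoc (a +√· b) (c +√· e) (f +√· g) = cong₂ _+√·_
      (solve 7 (λ a b c e f g D → (a :* c :+ D :* (b :* e)) :* f :+ D :* ((a :* e :+ b :* c) :* g)
                := a :* (c :* f :+ D :* (e :* g)) :+ D :* (b :* (c :* g :+ e :* f)))
               refl a b c e f g D)
      (solve 7 (λ a b c e f g D → (a :* c :+ D :* (b :* e)) :* g :+ (a :* e :+ b :* c) :* f
                := a :* (c :* g :+ e :* f) :+ b :* (c :* f :+ D :* (e :* g)))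
               refl a b c e f g D)
    distribˡ : ∀ x y z → x *ₖ (y +ₖ z) ≡ x *ₖ y +ₖ x *ₖ z
    distribˡ (a +√· b) (c +√· e) (f +√· g) = cong₂ _+√·_
      (solve 7 (λ a b c e f g D → a :* (c :+ f) :+ D :* (b :* (e :+ g))
                := a :* c :+ D :* (b :* e) :+ (a :* f :+ D :* (b :* g))) refl a b c e f g D)
      (solve 6 (λ a b c e f g → a :* (e :+ g) :+ b :* (c :+ f)
                := a :* e :+ b :* c :+ (a :* g :+ b :* f)) refl a b c e f g)

  ι : ℤ → K d
  ι = fromℤ

  ι-+ : ∀ m n → ι (m + n) ≡ ι m +ₖ ι n
  ι-+ m n = cong₂ _+√·_ (/1-homo-+ m n) refl

  ι-* : ∀ m n → ι (m * n) ≡ ι m *ₖ ι n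
  ι-* m n = cong₂ _+√·_
    (trans (/1-homo-* m n) (solve 3 (λ m n D → m :* n := m :* n :+ D :* (con 0ℚ :* con 0ℚ)) refl
      (m ℚ./ 1) (n ℚ./ 1) (d ℚ./ 1)))
    (solve 2 (λ m n → con 0ℚ := m :* con 0ℚ :+ con 0ℚ :* n) refl (m ℚ./ 1) (n ℚ./ 1))
    where open +-*-Solver

  ι-neg : ∀ m → ι (- m) ≡ negₖ (ι m)
  ι-neg m = cong₂ _+√·_ (/1-homo-neg m) refl

  ι-injective : ∀ {m n} → ι m ≡ ι n → m ≡ n
  ι-injective eq = /1-injective (cong K.rat eq)

  ι-≢0 : ∀ {m} → ¬ m ≡ 0ℤ → ¬ ι m ≡ 0ₖ
  ι-≢0 m≢0 eq = m≢0 (ι-injective eq)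

  √disc² : √disc *ₖ √disc ≡ ι d
  √disc² = cong₂ _+√·_
    (solve 1 (λ D → con 0ℚ :* con 0ℚ :+ D :* (con 1ℚ :* con 1ℚ) := D) refl (d ℚ./ 1)) refl
    where open +-*-Solver

  √disc-independent : ∀ m n → ι m *ₖ √disc +ₖ ι n ≡ 0ₖ → m ≡ 0ℤ × n ≡ 0ℤ
  √disc-independent m n eq =
      /1-injective (trans (solve 1 (λ m → m := m :* con 1ℚ :+ con 0ℚ :* con 0ℚ :+ con 0ℚ) refl (m ℚ./ 1))
                          (cong K.irr eq))
    , /1-injective (trans (solve 3 (λ m n D → n := m :* con 0ℚ :+ D :* (con 0ℚ :* con 1ℚ) :+ n) refl
                             (m ℚ./ 1) (n ℚ./ 1) (d ℚ./ 1))
                          (cong K.rat eq))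
    where open +-*-Solver

  -- Taking ℤ as the coefficient ring lets the solver normalise constants such as 2 and 4 inside K.
  ℤ⟶K : CommutativeRing.rawRing ℤ.+-*-commutativeRing -Raw-AlmostCommutative⟶ fromCommutativeRing K-commutativeRing
  ℤ⟶K = record
    { ⟦_⟧ = ι ; +-homo = ι-+ ; *-homo = ι-* ; -‿homo = ι-neg ; 0-homo = refl ; 1-homo = refl }

  private
    ι-cong? : ∀ m n → Maybe (ι m ≡ ι n)
    ι-cong? m n with m ℤ.≟ n
    ... | yes m≡n = just (cong ι m≡n)
    ... | no _    = nothing

  module KSolver = RingSolver _ (fromCommutativeRing K-commutativeRing) ℤ⟶K ι-cong?

  module _ where
    private
      open KSolver using (Polynomial; op; con; var; _:^_; :-_; [+]; [*]) renaming (⟦_⟧ to ⟦_⟧ₖ)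

      ⟦_⟧ℤ : ∀ {n} → Polynomial n → Vec ℤ n → ℤ
      ⟦ op [+] p q ⟧ℤ ρ = ⟦ p ⟧ℤ ρ + ⟦ q ⟧ℤ ρ
      ⟦ op [*] p q ⟧ℤ ρ = ⟦ p ⟧ℤ ρ * ⟦ q ⟧ℤ ρ
      ⟦ con c ⟧ℤ      ρ = c
      ⟦ var x ⟧ℤ      ρ = lookup ρ x
      ⟦ p :^ n ⟧ℤ     ρ = ⟦ p ⟧ℤ ρ ^ℤ n
      ⟦ :- p ⟧ℤ       ρ = - ⟦ p ⟧ℤ ρ

      ι-⟦⟧ : ∀ {n} (p : Polynomial n) ρ → ι (⟦ p ⟧ℤ ρ) ≡ ⟦ p ⟧ₖ (map ι ρ)
      ι-⟦⟧ (op [+] p q) ρ = trans (ι-+ (⟦ p ⟧ℤ ρ) (⟦ q ⟧ℤ ρ)) (cong₂ _+ₖ_ (ι-⟦⟧ p ρ) (ι-⟦⟧ q ρ))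
      ι-⟦⟧ (op [*] p q) ρ = trans (ι-* (⟦ p ⟧ℤ ρ) (⟦ q ⟧ℤ ρ)) (cong₂ _*ₖ_ (ι-⟦⟧ p ρ) (ι-⟦⟧ q ρ))
      ι-⟦⟧ (con c)      ρ = refl
      ι-⟦⟧ (var x)      ρ = sym (lookup-map x ι ρ)
      ι-⟦⟧ (p :^ zero)  ρ = refl
      ι-⟦⟧ (p :^ suc n) ρ = trans (ι-* (⟦ p ⟧ℤ ρ) (⟦ p ⟧ℤ ρ ^ℤ n)) (cong₂ _*ₖ_ (ι-⟦⟧ p ρ) (ι-⟦⟧ (p :^ n) ρ))
      ι-⟦⟧ (:- p)       ρ = trans (ι-neg (⟦ p ⟧ℤ ρ)) (cong negₖ (ι-⟦⟧ p ρ))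

    -- Carries an integer equation into K. Both sides are given as solver polynomials, so the
    -- homomorphism laws of `ι` are applied by one structural recursion.
    ι-equation : ∀ n (f : N-ary n (Polynomial n) (Polynomial n × Polynomial n)) (ρ : Vec ℤ n) →
      let p , q = f $ⁿ Vec.map var (allFin n) in ⟦ p ⟧ℤ ρ ≡ ⟦ q ⟧ℤ ρ → ⟦ p ⟧ₖ (map ι ρ) ≡ ⟦ q ⟧ₖ (map ι ρ)
    ι-equation n f ρ eq = let p , q = f $ⁿ Vec.map var (allFin n) in
      trans (sym (ι-⟦⟧ p ρ)) (trans (cong ι eq) (ι-⟦⟧ q ρ))

  module _ (d<0 : d < 0ℤ) where

    norm-≢0 : ∀ (x : K d) → ¬ x ≡ 0ₖ → ¬ norm x ≡ 0ℚ
    norm-≢0 x@(p +√· q) x≢0 N≡0 with q ℚ.≟ 0ℚ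
    ... | no q≢0 = ℚ.<-irrefl (sym N≡0) (subst (0ℚ ℚ.<_)
            (solve 3 (λ p q D → p :* p :+ :- D :* (q :* q) := p :* p :- D :* (q :* q)) refl p q (d ℚ./ 1))
            (ℚ.+-mono-≤-< (square-nonNegative p) (*-positive _ (q ℚ.* q) (neg/1-positive d d<0)
               (square-positive q q≢0))))
      where open +-*-Solver
    ... | yes refl with p ℚ.≟ 0ℚ
    ...   | yes refl = x≢0 refl
    ...   | no p≢0   = ℚ.<-irrefl (sym N≡0) (subst (0ℚ ℚ.<_)
            (solve 2 (λ p D → p :* p := p :* p :- D :* (con 0ℚ :* con 0ℚ)) refl p (d ℚ./ 1))
            (square-positive p p≢0))
      where open +-*-Solver

    invℚ-inverse : ∀ p → ¬ p ≡ 0ℚ → p ℚ.* invℚ p ≡ 1ℚ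
    invℚ-inverse p p≢0 with p ℚ.≟ 0ℚ
    ... | yes p≡0 = contradiction p≡0 p≢0
    ... | no p≢0′ = ℚ.*-inverseʳ p {{ℚ.≢-nonZero p≢0′}}

    invₖ-inverse : ∀ (x : K d) → ¬ x ≡ 0ₖ → x *ₖ invₖ x ≡ 1ₖ
    invₖ-inverse x@(p +√· q) x≢0 = cong₂ _+√·_
      (trans (solve 4 (λ p q D i → p :* (p :* i) :+ D :* (q :* (:- q :* i)) := (p :* p :- D :* (q :* q)) :* i)
               refl p q (d ℚ./ 1) (invℚ (norm x)))
             (invℚ-inverse (norm x) (norm-≢0 x x≢0)))
      (solve 3 (λ p q i → p :* (:- q :* i) :+ q :* (p :* i) := con 0ℚ) refl p q (invℚ (norm x)))
      where open +-*-Solver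

    open KSolver using (solve; con; _:=_; _:*_; _:+_; _:-_; :-_)

    /ₖ-*ₖ : ∀ x {y : K d} → ¬ y ≡ 0ₖ → y *ₖ (x /ₖ y) ≡ x
    /ₖ-*ₖ x {y} y≢0 = trans (solve 3 (λ x y i → y :* (x :* i) := x :* (y :* i)) refl x y (invₖ y))
      (trans (cong (x *ₖ_) (invₖ-inverse y y≢0)) (solve 1 (λ x → x :* con 1ℤ := x) refl x))

    *ₖ-cancelˡ : ∀ {x y z : K d} → ¬ x ≡ 0ₖ → x *ₖ y ≡ x *ₖ z → y ≡ z
    *ₖ-cancelˡ {x} {y} {z} x≢0 eq = begin
      y                    ≡⟨ cancel y ⟨
      invₖ x *ₖ (x *ₖ y)   ≡⟨ cong (invₖ x *ₖ_) eq ⟩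
      invₖ x *ₖ (x *ₖ z)   ≡⟨ cancel z ⟩
      z                    ∎
      where
      open ≡-Reasoning
      cancel : ∀ y → invₖ x *ₖ (x *ₖ y) ≡ y
      cancel y = trans (solve 3 (λ i x y → i :* (x :* y) := x :* i :* y) refl (invₖ x) x y)
        (trans (cong (_*ₖ y) (invₖ-inverse x x≢0)) (solve 1 (λ y → con 1ℤ :* y := y) refl y))

-- Lattices in K

module _ {d : ℤ} where

  open KSolver {d} using (solve; con; _:=_; _:*_; _:+_; _:-_; :-_)

  -- The counterpart of `lin` in K. It brings relations such as `2aw = -b + √d` into the solver,
  -- with `α` as cofactor.
  linₖ : ∀ {x y : K d} α {l r} → l ≡ r → x ≡ y +ₖ α *ₖ (l +ₖ negₖ r) → x ≡ y
  linₖ {x} {y} α {l} refl eq = trans eq (solve 3 (λ y α l → y :+ α :* (l :- l) := y) refl y α l)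

  1·ₖ : ∀ (x : K d) → 1ₖ *ₖ x ≡ x
  1·ₖ = solve 1 (λ x → con 1ℤ :* x := x) refl

  record IsℤSubmodule (P : Pred (K d) 0ℓ) : Set where
    field
      0∈  : 0ₖ ∈ P
      +∈  : ∀ {x y} → x ∈ P → y ∈ P → x +ₖ y ∈ P
      ι·∈ : ∀ n {x} → x ∈ P → ι n *ₖ x ∈ P
  open IsℤSubmodule

  lattice : ∀ α β → IsℤSubmodule [ α , β ]
  lattice α β = record
    { 0∈ = 0ℤ , 0ℤ , solve 2 (λ α β → con 0ℤ := con 0ℤ :* α :+ con 0ℤ :* β) refl α β
    ; +∈ = λ { {x} {y} (m , n , refl) (m′ , n′ , refl) → m + m′ , n + n′ ,
        trans (solve 6 (λ α β m n m′ n′ → m :* α :+ n :* β :+ (m′ :* α :+ n′ :* β) := (m :+ m′) :* α :+ (n :+ n′) :* β) refl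
                 α β (ι m) (ι n) (ι m′) (ι n′))
              (sym (cong₂ (λ M N → M *ₖ α +ₖ N *ₖ β) (ι-+ m m′) (ι-+ n n′))) }
    ; ι·∈ = λ { k {x} (m , n , refl) → k * m , k * n ,
        trans (solve 5 (λ α β k m n → k :* (m :* α :+ n :* β) := k :* m :* α :+ k :* n :* β) refl α β (ι k) (ι m) (ι n))
              (sym (cong₂ (λ M N → M *ₖ α +ₖ N *ₖ β) (ι-* k m) (ι-* k n))) }
    }

  first∈ : ∀ α β → α ∈ [ α , β ]
  first∈ α β = 1ℤ , 0ℤ , solve 2 (λ α β → α := con 1ℤ :* α :+ con 0ℤ :* β) refl α β

  second∈ : ∀ α β → β ∈ [ α , β ]
  second∈ α β = 0ℤ , 1ℤ , solve 2 (λ α β → β := con 0ℤ :* α :+ con 1ℤ :* β) refl α β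

  combination∈ : ∀ (α β : K d) m n → ι m *ₖ α +ₖ ι n *ₖ β ∈ [ α , β ]
  combination∈ α β m n = m , n , refl

  lattice⊆ : ∀ {α β P} → IsℤSubmodule P → α ∈ P → β ∈ P → [ α , β ] ⊆ P
  lattice⊆ P-sub α∈P β∈P (m , n , refl) = +∈ P-sub (ι·∈ P-sub m α∈P) (ι·∈ P-sub n β∈P)

  -- For `z ≠ 0` this is `z⁻¹P`. As a preimage it inherits the closure properties of `P` without any
  -- inversion.
  _⁻¹·_ : K d → Pred (K d) 0ℓ → Pred (K d) 0ℓ
  (z ⁻¹· P) x = z *ₖ x ∈ P

  ⁻¹·-submodule : ∀ {P} z → IsℤSubmodule P → IsℤSubmodule (z ⁻¹· P)
  ⁻¹·-submodule {P} z P-sub = record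
    { 0∈ = subst P (solve 1 (λ z → con 0ℤ := z :* con 0ℤ) refl z) (0∈ P-sub)
    ; +∈ = λ {x} {y} x∈ y∈ → subst P (solve 3 (λ x y z → z :* x :+ z :* y := z :* (x :+ y)) refl x y z) (+∈ P-sub x∈ y∈)
    ; ι·∈ = λ n {x} x∈ → subst P (solve 3 (λ n x z → n :* (z :* x) := z :* (n :* x)) refl (ι n) x z) (ι·∈ P-sub n x∈)
    }

  -- Bilinearity in two rounds: a basis element of the first lattice is multiplied by all of the
  -- second, then the element of the second lattice is held fixed.
  basis-products : ∀ {α β γ δ P} → IsℤSubmodule P → α *ₖ γ ∈ P → α *ₖ δ ∈ P → β *ₖ γ ∈ P → β *ₖ δ ∈ P →
    ∀ {x y} → x ∈ [ α , β ] → y ∈ [ γ , δ ] → x *ₖ y ∈ P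
  basis-products {α} {β} {γ} {δ} {P} P-sub αγ αδ βγ βδ {x} {y} x∈ y∈ = subst P (comm y x)
    (lattice⊆ (⁻¹·-submodule y P-sub)
      (subst P (comm α y) (lattice⊆ (⁻¹·-submodule α P-sub) αγ αδ y∈))
      (subst P (comm β y) (lattice⊆ (⁻¹·-submodule β P-sub) βγ βδ y∈)) x∈)
    where
    comm : ∀ x y → x *ₖ y ≡ y *ₖ x
    comm = solve 2 (λ x y → x :* y := y :* x) refl

  module _ {I J : Pred (K d) 0ℓ} where

    ·-∈ : ∀ {x y} → x ∈ I → y ∈ J → x *ₖ y ∈ I · J
    ·-∈ {x} {y} x∈ y∈ = subst (I · J) (solve 2 (λ x y → x :* y :+ con 0ℤ := x :* y) refl x y) (cons x∈ y∈ empty)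

    ·-⊆ : ∀ {P} → IsℤSubmodule P → (∀ {x y} → x ∈ I → y ∈ J → x *ₖ y ∈ P) → I · J ⊆ P
    ·-⊆ P-sub xy∈P empty            = 0∈ P-sub
    ·-⊆ P-sub xy∈P (cons x∈ y∈ z∈)  = +∈ P-sub (xy∈P x∈ y∈) (·-⊆ P-sub xy∈P z∈)

    ·-+∈ : ∀ {x y} → x ∈ I · J → y ∈ I · J → x +ₖ y ∈ I · J
    ·-+∈ {y = w} empty w∈ = subst (I · J) (solve 1 (λ w → w := con 0ℤ :+ w) refl w) w∈
    ·-+∈ {y = w} (cons {x} {y} {z} x∈ y∈ z∈) w∈ =
      subst (I · J) (solve 4 (λ x y z w → x :* y :+ (z :+ w) := x :* y :+ z :+ w) refl x y z w) (cons x∈ y∈ (·-+∈ z∈ w∈))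

    ·-scale : ∀ α → (∀ {x} → x ∈ I → α *ₖ x ∈ I) → ∀ {z} → z ∈ I · J → α *ₖ z ∈ I · J
    ·-scale α αI empty = subst (I · J) (solve 1 (λ α → con 0ℤ := α :* con 0ℤ) refl α) empty
    ·-scale α αI (cons {x} {y} {z} x∈ y∈ z∈) =
      subst (I · J) (solve 4 (λ α x y z → α :* x :* y :+ α :* z := α :* (x :* y :+ z)) refl α x y z)
        (cons (αI x∈) y∈ (·-scale α αI z∈))

    ·-submodule : IsℤSubmodule I → IsℤSubmodule (I · J)
    ·-submodule I-sub = record { 0∈ = empty ; +∈ = ·-+∈ ; ι·∈ = λ n → ·-scale (ι n) (ι·∈ I-sub n) }

  1∈𝒪 : 1ₖ ∈ 𝒪 {d}
  1∈𝒪 = second∈ _ 1ₖ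

  𝒪-submodule : IsℤSubmodule (𝒪 {d})
  𝒪-submodule = lattice _ 1ₖ

  ι∈𝒪 : ∀ n → ι n ∈ 𝒪 {d}
  ι∈𝒪 n = subst 𝒪 (solve 1 (λ n → n :* con 1ℤ := n) refl (ι n)) (ι·∈ 𝒪-submodule n 1∈𝒪)

  1ₖ≢0ₖ : ¬ 1ₖ {d} ≡ 0ₖ
  1ₖ≢0ₖ = ι-≢0 {d} {1ℤ} λ ()

  ·-𝒪submodule : ∀ {I J} → IsNonzero𝒪Submodule I → 1ₖ ∈ I → 1ₖ ∈ J → IsNonzero𝒪Submodule (I · J)
  ·-𝒪submodule {I} {J} I-sub 1∈I 1∈J = record
    { 0∈ = empty
    ; +-closed = ·-+∈
    ; 𝒪-closed = λ {α} α∈ z∈ → ·-scale α (IsNonzero𝒪Submodule.𝒪-closed I-sub α∈) z∈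
    ; nonzero = 1ₖ , subst (I · J) (1·ₖ 1ₖ) (·-∈ 1∈I 1∈J) , 1ₖ≢0ₖ
    }

-- The lattice of a form as a module over the ring of integers

module _ {d : ℤ} (d<0 : d < 0ℤ) where

  open KSolver {d} using (solve; con; _:=_; _:*_; _:+_; _:-_; :-_)
  open IsℤSubmodule

  τ : K d
  τ = (fromℤ d +ₖ √disc) /ₖ fromℤ (+ 2)

  2τ : ι (+ 2) *ₖ τ ≡ ι d +ₖ √disc
  2τ = /ₖ-*ₖ d<0 (ι d +ₖ √disc) (ι-≢0 {m = + 2} λ ())

  module FormLattice (Q : Form) (disc≡d : disc Q ≡ d) (a≢0 : ¬ Form.a Q ≡ 0ℤ) where
    open Form Q

    w : K d
    w = ω Q

    I : Pred (K d) 0ℓ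
    I = [ w , 1ₖ ]

    ω-equation : ι (+ 2 * a) *ₖ w ≡ ι (- b) +ₖ √disc
    ω-equation = /ₖ-*ₖ d<0 (ι (- b) +ₖ √disc) (ι-≢0 {m = + 2 * a} 2a≢0)
      where
      2a≢0 : ¬ + 2 * a ≡ 0ℤ
      2a≢0 2a≡0 = a≢0 (*-≢0-cancelˡ (+ 2) (λ ()) 2a≡0)

    2aw : ι (+ 2) *ₖ ι a *ₖ w ≡ negₖ (ι b) +ₖ √disc
    2aw = trans (cong (_*ₖ w) (sym (ι-* (+ 2) a))) (trans ω-equation (cong (_+ₖ √disc) (ι-neg b)))

    ιd≡ : ι b *ₖ ι b +ₖ negₖ (ι (+ 4) *ₖ ι a *ₖ ι c) ≡ ι {d} d
    ιd≡ = ι-equation 4 (λ a b c d → b :* b :- con (+ 4) :* a :* c := d) (a ∷ b ∷ c ∷ d ∷ []) disc≡d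

    ιa≢0 : ¬ ι {d} a ≡ 0ₖ
    ιa≢0 = ι-≢0 a≢0

    -- Squaring `2aw + b = √d` and cancelling `4a`.
    aw² : ι a *ₖ w *ₖ w ≡ negₖ (ι b) *ₖ w +ₖ negₖ (ι c)
    aw² = *ₖ-cancelˡ d<0 ιa≢0 (*ₖ-cancelˡ d<0 (ι-≢0 {m = + 4} λ ())
      (linₖ (ι (+ 2) *ₖ ι a *ₖ w +ₖ ι b +ₖ √disc) 2aw (linₖ 1ₖ √disc² (linₖ (negₖ 1ₖ) ιd≡
        (solve 6 (λ a b c w S D → con (+ 4) :* (a :* (a :* w :* w)) :=
           con (+ 4) :* (a :* (:- b :* w :+ :- c))
           :+ (con (+ 2) :* a :* w :+ b :+ S) :* (con (+ 2) :* a :* w :- (:- b :+ S))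
           :+ con 1ℤ :* (S :* S :- D) :+ :- con 1ℤ :* (b :* b :- con (+ 4) :* a :* c :- D)) refl
           (ι a) (ι b) (ι c) w √disc (ι d))))))

    n : ℤ
    n = proj₁ (parity Q)

    -- Hence 𝒪 is also `[aw , 1]`, and stability of `[w , 1]` under 𝒪 reduces to `aw² ∈ [w , 1]`.
    τ≡aw+n : τ ≡ ι a *ₖ w +ₖ ι n
    τ≡aw+n = *ₖ-cancelˡ d<0 (ι-≢0 {m = + 2} λ ()) (linₖ 1ₖ 2τ (linₖ (negₖ 1ₖ) 2aw (linₖ 1ₖ d+b≡2n
      (solve 7 (λ a b n τ w S D → con (+ 2) :* τ := con (+ 2) :* (a :* w :+ n)
         :+ con 1ℤ :* (con (+ 2) :* τ :- (D :+ S)) :+ :- con 1ℤ :* (con (+ 2) :* a :* w :- (:- b :+ S))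
         :+ con 1ℤ :* (D :+ b :- con (+ 2) :* n)) refl (ι a) (ι b) (ι n) τ w √disc (ι d)))))
      where
      d+b≡2n : ι {d} d +ₖ ι b ≡ ι (+ 2) *ₖ ι n
      d+b≡2n = ι-equation 3 (λ d b n → d :+ b := con (+ 2) :* n) (d ∷ b ∷ n ∷ [])
        (trans (cong (_+ b) (sym disc≡d)) (proj₂ (parity Q)))

    I-submodule : IsℤSubmodule I
    I-submodule = lattice w 1ₖ

    1∈I : 1ₖ ∈ I
    1∈I = second∈ w 1ₖ

    aw²∈I : ι a *ₖ w *ₖ w ∈ I
    aw²∈I = - b , - c , trans aw² (trans
      (solve 3 (λ b c w → :- b :* w :+ :- c := :- b :* w :+ :- c :* con 1ℤ) refl (ι b) (ι c) w)
      (cong₂ (λ B C → B *ₖ w +ₖ C *ₖ 1ₖ) (sym (ι-neg b)) (sym (ι-neg c))))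

    τw∈I : τ *ₖ w ∈ I
    τw∈I = subst I (trans (solve 3 (λ a n w → a :* w :* w :+ n :* w := (a :* w :+ n) :* w) refl (ι a) (ι n) w)
                          (cong (_*ₖ w) (sym τ≡aw+n)))
      (+∈ I-submodule aw²∈I (ι·∈ I-submodule n (first∈ w 1ₖ)))

    𝒪-closed : ∀ {α x} → α ∈ 𝒪 → x ∈ I → α *ₖ x ∈ I
    𝒪-closed = basis-products I-submodule τw∈I
      (subst I (trans (sym τ≡aw+n) (solve 1 (λ x → x := x :* con 1ℤ) refl τ))
        (+∈ I-submodule (ι·∈ I-submodule a (first∈ w 1ₖ)) (subst I (solve 1 (λ x → x :* con 1ℤ := x) refl (ι n)) (ι·∈ I-submodule n 1∈I))))
      (subst I (sym (1·ₖ w)) (first∈ w 1ₖ))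
      (subst I (sym (1·ₖ 1ₖ)) 1∈I)

    aw∈𝒪 : ι a *ₖ w ∈ 𝒪
    aw∈𝒪 = 1ℤ , - n , linₖ (negₖ 1ₖ) τ≡aw+n (linₖ (negₖ 1ₖ) (ι-neg n)
      (solve 5 (λ a n w τ n′ → a :* w := con 1ℤ :* τ :+ n′ :* con 1ℤ :+ :- con 1ℤ :* (τ :- (a :* w :+ n))
        :+ :- con 1ℤ :* (n′ :- (:- n))) refl (ι a) (ι n) w τ (ι (- n))))

    aI⊆𝒪 : ∀ {x} → x ∈ I → ι a *ₖ x ∈ 𝒪
    aI⊆𝒪 = lattice⊆ (⁻¹·-submodule (ι a) 𝒪-submodule) aw∈𝒪 (ι·∈ 𝒪-submodule a 1∈𝒪)

    -- Only `τ²` needs an argument, and the form supplies it: `τ² = a(τw) + nτ`, where `τw` lies in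
    -- `I` and `aI ⊆ 𝒪`. No case distinction on `d` modulo 4 arises.
    𝒪·𝒪⊆𝒪 : ∀ {x y} → x ∈ 𝒪 → y ∈ 𝒪 → x *ₖ y ∈ 𝒪
    𝒪·𝒪⊆𝒪 = basis-products 𝒪-submodule
      (subst 𝒪 (trans (solve 4 (λ a n w τ → a :* (τ :* w) :+ n :* τ := τ :* (a :* w :+ n)) refl (ι a) (ι n) w τ)
                      (cong (τ *ₖ_) (sym τ≡aw+n)))
        (+∈ 𝒪-submodule (aI⊆𝒪 τw∈I) (ι·∈ 𝒪-submodule n τ∈𝒪)))
      (subst 𝒪 (solve 1 (λ x → x := x :* con 1ℤ) refl τ) τ∈𝒪)
      (subst 𝒪 (sym (1·ₖ τ)) τ∈𝒪)
      (subst 𝒪 (sym (1·ₖ 1ₖ)) 1∈𝒪)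
      where
      τ∈𝒪 : τ ∈ 𝒪
      τ∈𝒪 = first∈ τ 1ₖ

    I-𝒪submodule : IsNonzero𝒪Submodule I
    I-𝒪submodule = record
      { 0∈ = 0∈ I-submodule ; +-closed = +∈ I-submodule ; 𝒪-closed = 𝒪-closed ; nonzero = 1ₖ , 1∈I , 1ₖ≢0ₖ }

    -- Multiplying the difference of the two sides by `2a` turns it into `M√d + L` with integers `M`
    -- and `L`, so independence of `√d` and 1 applies.
    independent : ∀ {m n m′ n′} → ι m *ₖ w +ₖ ι n ≡ ι m′ *ₖ w +ₖ ι n′ → m ≡ m′ × n ≡ n′
    independent {m} {n} {m′} {n′} eq = m≡m′ , ι-injective (linₖ 1ₖ eq (linₖ (negₖ w) (cong ι m≡m′)
        (solve 5 (λ m n m′ n′ w → n := n′ :+ con 1ℤ :* (m :* w :+ n :- (m′ :* w :+ n′)) :+ :- w :* (m :- m′)) refl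
          (ι m) (ι n) (ι m′) (ι n′) w)))
      where
      M = m - m′
      L = + 2 * a * (n - n′) - b * M
      ιM≡ : ι {d} M ≡ ι m +ₖ negₖ (ι m′)
      ιM≡ = ι-equation 3 (λ M m m′ → M := m :- m′) (M ∷ m ∷ m′ ∷ []) refl
      ιL≡ : ι {d} L ≡ ι (+ 2) *ₖ ι a *ₖ (ι n +ₖ negₖ (ι n′)) +ₖ negₖ (ι b *ₖ ι M)
      ιL≡ = ι-equation 6 (λ L a b n n′ M → L := con (+ 2) :* a :* (n :- n′) :- b :* M) (L ∷ a ∷ b ∷ n ∷ n′ ∷ M ∷ []) refl
      m≡m′ : m ≡ m′
      m≡m′ = ℤ.i-j≡0⇒i≡j m m′ (proj₁ (√disc-independent {d} M L (linₖ 1ₖ ιL≡ (linₖ (negₖ (ι M)) 2aw (linₖ (ι (+ 2) *ₖ ι a) eq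
        (linₖ (ι (+ 2) *ₖ ι a *ₖ w) ιM≡
        (solve 10 (λ m n m′ n′ w a b S M L → M :* S :+ L := con 0ℤ
           :+ con 1ℤ :* (L :- (con (+ 2) :* a :* (n :- n′) :- b :* M))
           :+ :- M :* (con (+ 2) :* a :* w :- (:- b :+ S))
           :+ con (+ 2) :* a :* (m :* w :+ n :- (m′ :* w :+ n′))
           :+ con (+ 2) :* a :* w :* (M :- (m :- m′))) refl
          (ι m) (ι n) (ι m′) (ι n′) w (ι a) (ι b) √disc (ι M) (ι L))))))))

-- Change of lattice basis under SL₂(ℤ)

module _ {d : ℤ} (d<0 : d < 0ℤ) where

  open KSolver {d} using (solve; con; _:=_; _:*_; _:+_; _:-_; :-_)
  open IsℤSubmodule

  -- α = γβ, cleared of its denominator.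
  record IsMöbius (γ : SL₂ℤ) (β α : K d) : Set where
    open SL₂ℤ γ
    field
      numerator : j γ β *ₖ α ≡ ι p *ₖ β +ₖ ι q

  module Möbius {γ β α} (möbius : IsMöbius γ β α) where
    open SL₂ℤ γ
    open IsMöbius möbius

    ιdet : ι p *ₖ ι s +ₖ negₖ (ι q *ₖ ι r) ≡ 1ₖ {d}
    ιdet = ι-equation 4 (λ p q r s → p :* s :- q :* r := con 1ℤ) (p ∷ q ∷ r ∷ s ∷ []) det

    -- `p - rα` is its inverse: `(p - rα) j = ps - qr = 1`.
    j≢0 : ¬ j γ β ≡ 0ₖ
    j≢0 j≡0 = 1ₖ≢0ₖ (linₖ (negₖ 1ₖ) ιdet (linₖ (ι p +ₖ negₖ (ι r *ₖ α)) j≡0 (linₖ (ι r) numerator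
      (solve 6 (λ p q r s α β → con 1ℤ := con 0ℤ :+ :- con 1ℤ :* (p :* s :- q :* r :- con 1ℤ)
         :+ (p :- r :* α) :* (r :* β :+ s :- con 0ℤ) :+ r :* ((r :* β :+ s) :* α :- (p :* β :+ q))) refl
         (ι p) (ι q) (ι r) (ι s) α β))))

    into : ∀ {x} → x ∈ [ α , 1ₖ ] → j γ β *ₖ x ∈ [ β , 1ₖ ]
    into = lattice⊆ (⁻¹·-submodule (j γ β) (lattice β 1ₖ))
      (subst [ β , 1ₖ ] (trans (solve 3 (λ p q β → p :* β :+ q :* con 1ℤ := p :* β :+ q) refl (ι p) (ι q) β) (sym numerator))
        (combination∈ β 1ₖ p q))
      (subst [ β , 1ₖ ] (solve 3 (λ r s β → r :* β :+ s :* con 1ℤ := (r :* β :+ s) :* con 1ℤ) refl (ι r) (ι s) β)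
        (combination∈ β 1ₖ r s))

    -- The old basis divided by `j` is integral in the new one: `β/j = sα - q` and `1/j = p - rα`.
    from : ∀ {x} → j γ β *ₖ x ∈ [ β , 1ₖ ] → x ∈ [ α , 1ₖ ]
    from {x} (m , n , jx≡) = subst [ α , 1ₖ ] (sym x≡)
      (+∈ sub (ι·∈ sub m (+∈ sub (ι·∈ sub s (first∈ α 1ₖ)) (ι·∈ sub (- q) (second∈ α 1ₖ))))
              (ι·∈ sub n (+∈ sub (ι·∈ sub (- r) (first∈ α 1ₖ)) (ι·∈ sub p (second∈ α 1ₖ)))))
      where
      sub = lattice α 1ₖ
      x≡ : x ≡ ι m *ₖ (ι s *ₖ α +ₖ ι (- q) *ₖ 1ₖ) +ₖ ι n *ₖ (ι (- r) *ₖ α +ₖ ι p *ₖ 1ₖ)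
      x≡ = *ₖ-cancelˡ d<0 j≢0 (linₖ 1ₖ jx≡ (linₖ (negₖ (ι m *ₖ ι s +ₖ negₖ (ι n *ₖ ι r))) numerator
        (linₖ (negₖ (ι m *ₖ β +ₖ ι n)) ιdet (linₖ (negₖ (ι m *ₖ j γ β)) (ι-neg q) (linₖ (negₖ (ι n *ₖ j γ β *ₖ α)) (ι-neg r)
        (solve 11 (λ m n p q r s α β x q′ r′ → (r :* β :+ s) :* x :=
            (r :* β :+ s) :* (m :* (s :* α :+ q′ :* con 1ℤ) :+ n :* (r′ :* α :+ p :* con 1ℤ))
            :+ con 1ℤ :* ((r :* β :+ s) :* x :- (m :* β :+ n :* con 1ℤ))
            :+ :- (m :* s :- n :* r) :* ((r :* β :+ s) :* α :- (p :* β :+ q))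
            :+ :- (m :* β :+ n) :* (p :* s :- q :* r :- con 1ℤ)
            :+ :- (m :* (r :* β :+ s)) :* (q′ :- (:- q)) :+ :- (n :* (r :* β :+ s) :* α) :* (r′ :- (:- r))) refl
          (ι m) (ι n) (ι p) (ι q) (ι r) (ι s) α β x (ι (- q)) (ι (- r))))))))

  -- Cleared of denominators, both relations read `rαβ + sα = pβ + q`, so no inverse of `γ` has to
  -- be applied.
  möbius-⁻¹ : ∀ {γ α β} → IsMöbius (γ ⁻¹) α β → IsMöbius γ β α
  möbius-⁻¹ {γ@(mkSL₂ p q r s _)} {α} {β} möbius = record { numerator =
    linₖ (negₖ 1ₖ) (IsMöbius.numerator möbius) (linₖ (α *ₖ β) (ι-neg r) (linₖ (negₖ 1ₖ) (ι-neg q)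
      (solve 8 (λ p q r s α β q′ r′ → (r :* β :+ s) :* α := p :* β :+ q
        :+ :- con 1ℤ :* ((r′ :* α :+ p) :* β :- (s :* α :+ q′))
        :+ α :* β :* (r′ :- (:- r)) :+ :- con 1ℤ :* (q′ :- (:- q))) refl
        (ι p) (ι q) (ι r) (ι s) α β (ι (- q)) (ι (- r))))) }

  -- Both roots carry the same sign of `√d`, so `√d = 2a″w″ + b″` can be substituted into
  -- `2aw = -b + √d`; this singles out the right root. Reducing `w″²` by its quadratic equation
  -- leaves the coefficients of `w″` and 1, which `i₁` and `i₂` compare.
  ω-^ : ∀ Q γ → disc Q ≡ d → ¬ Form.a Q ≡ 0ℤ → ¬ Form.a (Q ^ γ) ≡ 0ℤ → IsMöbius γ (ω (Q ^ γ)) (ω Q)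
  ω-^ Q@(form a b c) γ@(mkSL₂ p q r s det) D≡d a≢0 a″≢0 = record { numerator =
    *ₖ-cancelˡ d<0 L.ιa≢0 (*ₖ-cancelˡ d<0 (ι-≢0 {m = + 2} λ ())
      (linₖ (j γ w″) L.2aw (linₖ (negₖ (j γ w″)) L″.2aw (linₖ (ι (+ 2) *ₖ ι r) L″.aw² (linₖ w″ i₁ (linₖ 1ₖ i₂
        (solve 12 (λ a b a″ b″ c″ p q r s w w″ S → con (+ 2) :* (a :* ((r :* w″ :+ s) :* w)) :=
          con (+ 2) :* (a :* (p :* w″ :+ q))
          :+ (r :* w″ :+ s) :* (con (+ 2) :* a :* w :- (:- b :+ S))
          :+ :- (r :* w″ :+ s) :* (con (+ 2) :* a″ :* w″ :- (:- b″ :+ S))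
          :+ con (+ 2) :* r :* (a″ :* w″ :* w″ :- (:- b″ :* w″ :+ :- c″))
          :+ w″ :* (con (+ 2) :* a″ :* s :- r :* (b″ :+ b) :- con (+ 2) :* a :* p)
          :+ con 1ℤ :* (s :* (b″ :- b) :- con (+ 2) :* r :* c″ :- con (+ 2) :* a :* q)) refl
          (ι a) (ι b) (ι a″) (ι b″) (ι c″) (ι p) (ι q) (ι r) (ι s) w w″ √disc))))))) }
    where
    open Form (Q ^ γ) using () renaming (a to a″; b to b″; c to c″)
    module L = FormLattice d<0 Q D≡d a≢0
    module L″ = FormLattice d<0 (Q ^ γ) (trans (disc-^ Q γ) D≡d) a″≢0
    w = ω Q
    w″ = ω (Q ^ γ)
    identity₁ : ∀ a b c p q r s → + 2 * (a * (p * p) + b * (p * r) + c * (r * r)) * s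
        - r * (+ 2 * a * (p * q) + b * (p * s + q * r) + + 2 * c * (r * s) + b)
      ≡ + 2 * a * p + (+ 2 * a * p + b * r) * (p * s - q * r - 1ℤ)
    identity₁ = solve-∀
    i₁ : ι (+ 2) *ₖ ι a″ *ₖ ι s +ₖ negₖ (ι r *ₖ (ι b″ +ₖ ι b)) ≡ ι {d} (+ 2) *ₖ ι a *ₖ ι p
    i₁ = ι-equation 7 (λ a b a″ b″ p r s → con (+ 2) :* a″ :* s :- r :* (b″ :+ b) := con (+ 2) :* a :* p)
      (a ∷ b ∷ a″ ∷ b″ ∷ p ∷ r ∷ s ∷ []) (lin (+ 2 * a * p + b * r) det (identity₁ a b c p q r s))
    identity₂ : ∀ a b c p q r s → s * (+ 2 * a * (p * q) + b * (p * s + q * r) + + 2 * c * (r * s) - b)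
        - + 2 * r * (a * (q * q) + b * (q * s) + c * (s * s))
      ≡ + 2 * a * q + (+ 2 * a * q + b * s) * (p * s - q * r - 1ℤ)
    identity₂ = solve-∀
    i₂ : ι s *ₖ (ι b″ +ₖ negₖ (ι b)) +ₖ negₖ (ι (+ 2) *ₖ ι r *ₖ ι c″) ≡ ι {d} (+ 2) *ₖ ι a *ₖ ι q
    i₂ = ι-equation 7 (λ a b b″ c″ q r s → s :* (b″ :- b) :- con (+ 2) :* r :* c″ := con (+ 2) :* a :* q)
      (a ∷ b ∷ b″ ∷ c″ ∷ q ∷ r ∷ s ∷ []) (lin (+ 2 * a * q + b * s) det (identity₂ a b c p q r s))

  -- Dirichlet composition of lattices

  module Dirichlet (Q Q″ : Form) (D≡d : disc Q ≡ d) (D″≡d : disc Q″ ≡ d)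
      (a≢0 : ¬ Form.a Q ≡ 0ℤ) (a″≢0 : ¬ Form.a Q″ ≡ 0ℤ) (composable : Composable Q Q″)
      (B X Y E : ℤ)
      (B-b≡ : B - Form.b Q ≡ X * (+ 2 * Form.a Q)) (B-b″≡ : B - Form.b Q″ ≡ Y * (+ 2 * Form.a Q″))
      (B²-d≡ : B * B - d ≡ E * (+ 4 * (Form.a Q * Form.a Q″))) where

    open Form Q
    open Form Q″ renaming (a to a″; b to b″; c to c″)
    open Composable composable

    C : Form
    C = form (a * a″) B E

    aa″≢0 : ¬ a * a″ ≡ 0ℤ
    aa″≢0 aa″≡0 = a″≢0 (*-≢0-cancelˡ a a≢0 (trans aa″≡0 (sym (ℤ.*-zeroʳ a))))

    disc-C : disc C ≡ d
    disc-C = lin 1ℤ B²-d≡ (identity a a″ B d E)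
      where
      identity : ∀ a a″ B d E → B * B - + 4 * (a * a″) * E
        ≡ d + 1ℤ * (B * B - d - E * (+ 4 * (a * a″)))
      identity = solve-∀

    module L = FormLattice d<0 Q D≡d a≢0
    module L″ = FormLattice d<0 Q″ D″≡d a″≢0
    module LC = FormLattice d<0 C disc-C aa″≢0

    w w″ θ : K d
    w = ω Q
    w″ = ω Q″
    θ = ω C

    2aa″θ : ι (+ 2) *ₖ (ι a *ₖ ι a″) *ₖ θ ≡ negₖ (ι B) +ₖ √disc
    2aa″θ = trans (cong (λ z → ι (+ 2) *ₖ z *ₖ θ) (sym (ι-* a a″))) LC.2aw

    w≡ : w ≡ ι a″ *ₖ θ +ₖ ι X
    w≡ = *ₖ-cancelˡ d<0 L.ιa≢0 (*ₖ-cancelˡ d<0 (ι-≢0 {m = + 2} λ ())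
      (linₖ 1ₖ L.2aw (linₖ (negₖ 1ₖ) 2aa″θ (linₖ 1ₖ
        (ι-equation 4 (λ a b B X → B :- b := X :* (con (+ 2) :* a)) (a ∷ b ∷ B ∷ X ∷ []) B-b≡)
        (solve 8 (λ a b a″ B X w θ S → con (+ 2) :* (a :* w) := con (+ 2) :* (a :* (a″ :* θ :+ X))
          :+ con 1ℤ :* (con (+ 2) :* a :* w :- (:- b :+ S))
          :+ :- con 1ℤ :* (con (+ 2) :* (a :* a″) :* θ :- (:- B :+ S))
          :+ con 1ℤ :* (B :- b :- X :* (con (+ 2) :* a))) refl (ι a) (ι b) (ι a″) (ι B) (ι X) w θ √disc)))))

    w″≡ : w″ ≡ ι a *ₖ θ +ₖ ι Y
    w″≡ = *ₖ-cancelˡ d<0 L″.ιa≢0 (*ₖ-cancelˡ d<0 (ι-≢0 {m = + 2} λ ())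
      (linₖ 1ₖ L″.2aw (linₖ (negₖ 1ₖ) 2aa″θ (linₖ 1ₖ
        (ι-equation 4 (λ a b B X → B :- b := X :* (con (+ 2) :* a)) (a″ ∷ b″ ∷ B ∷ Y ∷ []) B-b″≡)
        (solve 8 (λ a a″ b″ B Y w″ θ S → con (+ 2) :* (a″ :* w″) := con (+ 2) :* (a″ :* (a :* θ :+ Y))
          :+ con 1ℤ :* (con (+ 2) :* a″ :* w″ :- (:- b″ :+ S))
          :+ :- con 1ℤ :* (con (+ 2) :* (a :* a″) :* θ :- (:- B :+ S))
          :+ con 1ℤ :* (B :- b″ :- Y :* (con (+ 2) :* a″))) refl (ι a) (ι a″) (ι b″) (ι B) (ι Y) w″ θ √disc)))))

    a″Y+aX≡B-s : a″ * Y + a * X ≡ B - s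
    a″Y+aX≡B-s = *-≢0-cancelˡ (+ 2) (λ ()) (lin (- 1ℤ) B-b≡ (lin (- 1ℤ) B-b″≡ (lin (- 1ℤ) b+b″≡2s (identity a b a″ b″ B X Y s))))
      where
      identity : ∀ a b a″ b″ B X Y s → + 2 * (a″ * Y + a * X) ≡ + 2 * (B - s)
        + (- 1ℤ) * (B - b - X * (+ 2 * a)) + (- 1ℤ) * (B - b″ - Y * (+ 2 * a″))
        + (- 1ℤ) * (b + b″ - + 2 * s)
      identity = solve-∀

    ww″≡ : w *ₖ w″ ≡ negₖ (ι s) *ₖ θ +ₖ (ι X *ₖ ι Y +ₖ negₖ (ι E))
    ww″≡ = trans (cong₂ _*ₖ_ w≡ w″≡) (linₖ 1ₖ aa″θ² (linₖ θ
        (ι-equation 6 (λ a a″ B X Y s → a″ :* Y :+ a :* X := B :- s) (a ∷ a″ ∷ B ∷ X ∷ Y ∷ s ∷ []) a″Y+aX≡B-s)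
        (solve 8 (λ a a″ B X Y E s θ → (a″ :* θ :+ X) :* (a :* θ :+ Y) := :- s :* θ :+ (X :* Y :- E)
          :+ con 1ℤ :* (a :* a″ :* θ :* θ :- (:- B :* θ :- E)) :+ θ :* (a″ :* Y :+ a :* X :- (B :- s))) refl
          (ι a) (ι a″) (ι B) (ι X) (ι Y) (ι E) (ι s) θ)))
      where
      aa″θ² : ι a *ₖ ι a″ *ₖ θ *ₖ θ ≡ negₖ (ι B) *ₖ θ +ₖ negₖ (ι E)
      aa″θ² = trans (cong (λ z → z *ₖ θ *ₖ θ) (sym (ι-* a a″))) LC.aw²

    product⊆ : ∀ {x y} → x ∈ [ w , 1ₖ ] → y ∈ [ w″ , 1ₖ ] → x *ₖ y ∈ [ θ , 1ₖ ]
    product⊆ = basis-products sub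
      (subst [ θ , 1ₖ ] ww″-eq (combination∈ θ 1ₖ (- s) (X * Y - E)))
      (subst [ θ , 1ₖ ] (trans (solve 3 (λ a x θ → a :* θ :+ x :* con 1ℤ := (a :* θ :+ x) :* con 1ℤ) refl (ι a″) (ι X) θ) (cong (_*ₖ 1ₖ) (sym w≡)))
        (combination∈ θ 1ₖ a″ X))
      (subst [ θ , 1ₖ ] (trans (solve 3 (λ a x θ → a :* θ :+ x :* con 1ℤ := con 1ℤ :* (a :* θ :+ x)) refl (ι a) (ι Y) θ) (cong (1ₖ *ₖ_) (sym w″≡)))
        (combination∈ θ 1ₖ a Y))
      (subst [ θ , 1ₖ ] (sym (1·ₖ 1ₖ)) (second∈ θ 1ₖ))
      where
      sub = lattice θ 1ₖ
      ww″-eq : ι (- s) *ₖ θ +ₖ ι (X * Y - E) *ₖ 1ₖ ≡ w *ₖ w″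
      ww″-eq = linₖ (negₖ 1ₖ) ww″≡ (linₖ θ (ι-neg s) (linₖ 1ₖ
        (ι-equation 4 (λ X Y E Z → Z := X :* Y :- E) (X ∷ Y ∷ E ∷ (X * Y - E) ∷ []) refl)
        (solve 8 (λ X Y E s s′ Z θ W → s′ :* θ :+ Z :* con 1ℤ := W :+ :- con 1ℤ :* (W :- (:- s :* θ :+ (X :* Y :- E)))
           :+ θ :* (s′ :- (:- s)) :+ con 1ℤ :* (Z :- (X :* Y :- E))) refl
           (ι X) (ι Y) (ι E) (ι s) (ι (- s)) (ι (X * Y - E)) θ (w *ₖ w″))))

    -- Up to integers, the products `w″`, `w` and `-ww″` are `aθ`, `a″θ` and `sθ`. Concordance makes
    -- `θ` an integral combination of these three.
    ⊆product : [ θ , 1ₖ ] ⊆ [ w , 1ₖ ] · [ w″ , 1ₖ ]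
    ⊆product = lattice⊆ sub (subst P (sym θ≡)
        (+∈ sub (ι·∈ sub l (+∈ sub (·-∈ L.1∈I (first∈ w″ 1ₖ)) (ι·∈ sub (- Y) one∈)))
        (+∈ sub (ι·∈ sub m (+∈ sub (·-∈ (first∈ w 1ₖ) L″.1∈I) (ι·∈ sub (- X) one∈)))
                (ι·∈ sub n (+∈ sub (ι·∈ sub (- 1ℤ) (·-∈ (first∈ w 1ₖ) (first∈ w″ 1ₖ))) (ι·∈ sub Z one∈))))))
        (subst P (1·ₖ 1ₖ) one∈)
      where
      P = [ w , 1ₖ ] · [ w″ , 1ₖ ]
      sub : IsℤSubmodule P
      sub = ·-submodule (lattice w 1ₖ)
      one∈ : 1ₖ *ₖ 1ₖ ∈ P
      one∈ = ·-∈ L.1∈I L″.1∈I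
      Z = X * Y - E
      θ≡ : θ ≡ ι l *ₖ (1ₖ *ₖ w″ +ₖ ι (- Y) *ₖ (1ₖ *ₖ 1ₖ))
            +ₖ (ι m *ₖ (w *ₖ 1ₖ +ₖ ι (- X) *ₖ (1ₖ *ₖ 1ₖ))
            +ₖ ι n *ₖ (ι (- 1ℤ) *ₖ (w *ₖ w″) +ₖ ι Z *ₖ (1ₖ *ₖ 1ₖ)))
      θ≡ = linₖ (negₖ θ) ι-bezout (linₖ (negₖ (ι l)) w″≡ (linₖ (negₖ (ι m)) w≡ (linₖ (ι n) ww″≡
        (linₖ (negₖ (ι l)) (ι-neg Y) (linₖ (negₖ (ι m)) (ι-neg X) (linₖ (negₖ (ι n))
          (ι-equation 4 (λ X Y E Z → Z := X :* Y :- E) (X ∷ Y ∷ E ∷ Z ∷ []) refl)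
        (solve 16 (λ l m n a a″ s X Y E X′ Y′ Z θ w w″ W → θ :=
            l :* (con 1ℤ :* w″ :+ Y′ :* (con 1ℤ :* con 1ℤ))
            :+ (m :* (w :* con 1ℤ :+ X′ :* (con 1ℤ :* con 1ℤ)) :+ n :* (con (- 1ℤ) :* W :+ Z :* (con 1ℤ :* con 1ℤ)))
            :+ :- θ :* (l :* a :+ m :* a″ :+ n :* s :- con 1ℤ)
            :+ :- l :* (w″ :- (a :* θ :+ Y)) :+ :- m :* (w :- (a″ :* θ :+ X))
            :+ n :* (W :- (:- s :* θ :+ (X :* Y :- E)))
            :+ :- l :* (Y′ :- (:- Y)) :+ :- m :* (X′ :- (:- X)) :+ :- n :* (Z :- (X :* Y :- E))) refl
          (ι l) (ι m) (ι n) (ι a) (ι a″) (ι s) (ι X) (ι Y) (ι E) (ι (- X)) (ι (- Y)) (ι Z) θ w w″ (w *ₖ w″))))))))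
        where
        ι-bezout : ι l *ₖ ι a +ₖ ι m *ₖ ι a″ +ₖ ι n *ₖ ι s ≡ 1ₖ {d}
        ι-bezout = ι-equation 6 (λ l m n a a″ s → l :* a :+ m :* a″ :+ n :* s := con 1ℤ) (l ∷ m ∷ n ∷ a ∷ a″ ∷ s ∷ []) bezout-aa″s

-- Ray classes

module RayClass {d : ℤ} (d<0 : d < 0ℤ) (𝒪·𝒪⊆𝒪 : ∀ {x y : K d} → x ∈ 𝒪 → y ∈ 𝒪 → x *ₖ y ∈ 𝒪)
    {𝔫 : Pred (K d) 0ℓ} (𝔫-submodule : IsNonzero𝒪Submodule 𝔫) (N : ℕ) (N∈𝔫 : ι (+ N) ∈ 𝔫) where

  open KSolver {d} using (solve; con; _:=_; _:*_; _:+_; _:-_; :-_)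
  open IsNonzero𝒪Submodule

  CoprimeToN : ℤ → Set
  CoprimeToN k = ∃₂ λ m n → m * k + n * + N ≡ 1ℤ

  ι-coprime : ∀ {k m n} → m * k + n * + N ≡ 1ℤ → ι m *ₖ ι k +ₖ ι n *ₖ ι (+ N) ≡ 1ₖ {d}
  ι-coprime {k} {m} {n} = ι-equation 4 (λ m k n N → m :* k :+ n :* N := con 1ℤ) (m ∷ k ∷ n ∷ + N ∷ [])

  principal : ∀ {β : K d} → β ∈ 𝒪 → ¬ β ≡ 0ₖ → IsNonzeroIdeal ⟨ β ⟩
  principal {β} β∈𝒪 β≢0 = record
    { submodule = record
      { 0∈ = 0ₖ , IsℤSubmodule.0∈ 𝒪-submodule , solve 1 (λ β → con 0ℤ := β :* con 0ℤ) refl β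
      ; +-closed = λ { (x , x∈ , refl) (y , y∈ , refl) → x +ₖ y , IsℤSubmodule.+∈ 𝒪-submodule x∈ y∈
                     , solve 3 (λ β x y → β :* x :+ β :* y := β :* (x :+ y)) refl β x y }
      ; 𝒪-closed = λ { {α} α∈ (x , x∈ , refl) → α *ₖ x , 𝒪·𝒪⊆𝒪 α∈ x∈
                     , solve 3 (λ α β x → α :* (β :* x) := β :* (α :* x)) refl α β x }
      ; nonzero = β , (1ₖ , 1∈𝒪 , solve 1 (λ β → β := β :* con 1ℤ) refl β) , β≢0 }
    ; integral = λ { (x , x∈ , refl) → 𝒪·𝒪⊆𝒪 β∈𝒪 x∈ }
    }

  -- If 1 ∈ I and kI ⊆ 𝒪 then I = (kI)⟨k⟩⁻¹, where both kI and ⟨k⟩ contain k.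
  isPrimeTo : ∀ {I : Pred (K d) 0ℓ} → IsNonzero𝒪Submodule I → 1ₖ ∈ I → ∀ k → ¬ k ≡ 0ℤ →
    (∀ {x} → x ∈ I → ι k *ₖ x ∈ 𝒪) → CoprimeToN k → IsPrimeTo 𝔫 I
  isPrimeTo {I} I-sub 1∈I k k≢0 kI⊆𝒪 (m , n , eq) = record
    { fractional = record
      { submodule = I-sub ; denominator = ι k ; denominator∈𝒪 = ι∈𝒪 k ; denominator≢0 = ι-≢0 k≢0
      ; clearsDenominator = kI⊆𝒪 }
    ; A = kI
    ; B = ⟨ ι k ⟩
    ; A-ideal = record
      { submodule = record
        { 0∈ = IsℤSubmodule.0∈ kI-submodule
        ; +-closed = IsℤSubmodule.+∈ kI-submodule
        ; 𝒪-closed = λ { {α} α∈ (x , x∈ , refl) → α *ₖ x , 𝒪-closed I-sub α∈ x∈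
                       , solve 3 (λ α k x → α :* (k :* x) := k :* (α :* x)) refl α (ι k) x }
        ; nonzero = ι k , (1ₖ , 1∈I , solve 1 (λ k → k := k :* con 1ℤ) refl (ι k)) , ι-≢0 k≢0 }
      ; integral = λ { (x , x∈ , refl) → kI⊆𝒪 x∈ } }
    ; B-ideal = principal (ι∈𝒪 k) (ι-≢0 k≢0)
    ; A-comaximal = ι k *ₖ (ι m *ₖ 1ₖ) , ι n *ₖ ι (+ N) , (ι m *ₖ 1ₖ , 𝒪-closed I-sub (ι∈𝒪 m) 1∈I , refl)
                  , 𝒪-closed 𝔫-submodule (ι∈𝒪 n) N∈𝔫
                  , trans (solve 4 (λ k m n N → k :* (m :* con 1ℤ) :+ n :* N := m :* k :+ n :* N) refl (ι k) (ι m) (ι n) (ι (+ N)))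
                          (ι-coprime {k} {m} {n} eq)
    ; B-comaximal = ι k *ₖ ι m , ι n *ₖ ι (+ N) , (ι m , ι∈𝒪 m , refl) , 𝒪-closed 𝔫-submodule (ι∈𝒪 n) N∈𝔫
                  , trans (solve 4 (λ k m n N → k :* m :+ n :* N := m :* k :+ n :* N) refl (ι k) (ι m) (ι n) (ι (+ N)))
                          (ι-coprime {k} {m} {n} eq)
    ; quotient = ·-⊆ kI-submodule (λ { {_} {y} (x , x∈ , refl) y∈ → x *ₖ y , 𝒪-closed I-sub x∈ y∈
                       , solve 3 (λ k x y → k :* x :* y := k :* (x :* y)) refl (ι k) x y })
               , λ { (x , x∈ , refl) → ·-∈ (1ₖ , 1∈𝒪 , solve 1 (λ k → k := k :* con 1ℤ) refl (ι k)) x∈ }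
    }
    where
    kI : Pred (K d) 0ℓ
    kI z = ∃ λ x → x ∈ I × z ≡ ι k *ₖ x
    kI-submodule : IsℤSubmodule kI
    kI-submodule = record
      { 0∈ = 0ₖ , 0∈ I-sub , solve 1 (λ k → con 0ℤ := k :* con 0ℤ) refl (ι k)
      ; +∈ = λ { (x , x∈ , refl) (y , y∈ , refl) → x +ₖ y , +-closed I-sub x∈ y∈
               , solve 3 (λ k x y → k :* x :+ k :* y := k :* (x :+ y)) refl (ι k) x y }
      ; ι·∈ = λ { n (x , x∈ , refl) → ι n *ₖ x , 𝒪-closed I-sub (ι∈𝒪 n) x∈
                , solve 3 (λ k n x → n :* (k :* x) := k :* (n :* x)) refl (ι k) (ι n) x }
      }

  module _ {k : ℤ} (k≢0 : ¬ k ≡ 0ℤ) (k-coprime : CoprimeToN k) {y : K d} (ky∈𝒪 : ι k *ₖ y ∈ 𝒪) where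

    -- Written over the denominator `k`, so that the integral numerator and denominator serve
    -- directly as `α` and `β` of the congruence.
    1+Ny : K d
    1+Ny = (ι k +ₖ ι (+ N) *ₖ (ι k *ₖ y)) /ₖ ι k

    k[1+Ny] : ι k *ₖ 1+Ny ≡ ι k +ₖ ι (+ N) *ₖ (ι k *ₖ y)
    k[1+Ny] = /ₖ-*ₖ d<0 (ι k +ₖ ι (+ N) *ₖ (ι k *ₖ y)) (ι-≢0 k≢0)

    1+Ny≡*1 : ¬ 1+Ny ≡ 0ₖ → 1+Ny ≡*1mod 𝔫
    1+Ny≡*1 ν≢0 = let m , n , eq = k-coprime in record
      { ν≢0 = ν≢0
      ; α = ι k +ₖ ι (+ N) *ₖ (ι k *ₖ y)
      ; β = ι k
      ; α∈𝒪 = IsℤSubmodule.+∈ 𝒪-submodule (ι∈𝒪 k) (𝒪·𝒪⊆𝒪 (ι∈𝒪 (+ N)) ky∈𝒪)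
      ; β∈𝒪 = ι∈𝒪 k
      ; β≢0 = ι-≢0 k≢0
      -- The terms in `y` cancel: `(k + Nky)m + (n - mky)N = mk + nN = 1`.
      ; α-comaximal = (ι k +ₖ ι (+ N) *ₖ (ι k *ₖ y)) *ₖ ι m , (ι n +ₖ ι (- m) *ₖ (ι k *ₖ y)) *ₖ ι (+ N)
          , (ι m , ι∈𝒪 m , refl)
          , 𝒪-closed 𝔫-submodule (IsℤSubmodule.+∈ 𝒪-submodule (ι∈𝒪 n) (IsℤSubmodule.ι·∈ 𝒪-submodule (- m) ky∈𝒪)) N∈𝔫
          , linₖ 1ₖ (ι-coprime {k} {m} {n} eq) (linₖ (ι k *ₖ y *ₖ ι (+ N)) (ι-neg m)
              (solve 6 (λ k N y m n m′ → (k :+ N :* (k :* y)) :* m :+ (n :+ m′ :* (k :* y)) :* N := con 1ℤ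
                :+ con 1ℤ :* (m :* k :+ n :* N :- con 1ℤ) :+ k :* y :* N :* (m′ :- (:- m))) refl
                (ι k) (ι (+ N)) y (ι m) (ι n) (ι (- m))))
      ; β-comaximal = ι k *ₖ ι m , ι n *ₖ ι (+ N) , (ι m , ι∈𝒪 m , refl) , 𝒪-closed 𝔫-submodule (ι∈𝒪 n) N∈𝔫
          , trans (solve 4 (λ k m n N → k :* m :+ n :* N := m :* k :+ n :* N) refl (ι k) (ι m) (ι n) (ι (+ N)))
                  (ι-coprime {k} {m} {n} eq)
      ; α≡β = subst 𝔫 (solve 3 (λ k N z → z :* N := k :+ N :* z :- k) refl (ι k) (ι (+ N)) (ι k *ₖ y))
                (𝒪-closed 𝔫-submodule ky∈𝒪 N∈𝔫)
      ; fraction = refl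
      }

-- The product of the two classes and the composite form

module Composition {d : ℤ} (d-fundamental : IsImaginaryQuadraticDiscriminant d)
    {𝔫 : Pred (K d) 0ℓ} (𝔫-submodule : IsNonzero𝒪Submodule 𝔫) (N : ℕ) (0<N : 0 ℕ.< N) (N∈𝔫 : ι (+ N) ∈ 𝔫)
    (Q Q′ : Form) (Q∈𝒬 : 𝒬[ N ] d Q) (Q′∈𝒬 : 𝒬[ N ] d Q′) (γ : SL₂ℤ) (concordant : Concordant Q (Q′ ^ γ)) where

  open Form Q
  open Form Q′ using () renaming (a to a′; b to b′; c to c′)
  open SL₂ℤ γ
  open IsℤSubmodule
  open KSolver {d} using (solve; con; _:=_; _:*_; _:+_; _:-_; :-_)

  Q″ : Form
  Q″ = Q′ ^ γ

  open Form Q″ using () renaming (a to a″; b to b″; c to c″)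

  d<0 : d < 0ℤ
  d<0 = disc-negative d-fundamental

  D≡d : disc Q ≡ d
  D≡d = 𝒬.discriminant (𝒬[_].inQ Q∈𝒬)

  D′≡d : disc Q′ ≡ d
  D′≡d = 𝒬.discriminant (𝒬[_].inQ Q′∈𝒬)

  D″≡d : disc Q″ ≡ d
  D″≡d = trans (disc-^ Q′ γ) D′≡d

  0<a : 0ℤ < a
  0<a = leading-positive Q (𝒬.positiveDefinite (𝒬[_].inQ Q∈𝒬))

  0<a′ : 0ℤ < a′
  0<a′ = leading-positive Q′ (𝒬.positiveDefinite (𝒬[_].inQ Q′∈𝒬))

  0<a″ : 0ℤ < a″
  0<a″ = leading-positive Q″ (positiveDefinite-^ {Q′} γ (𝒬.positiveDefinite (𝒬[_].inQ Q′∈𝒬)))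

  a≢0 : ¬ a ≡ 0ℤ
  a≢0 = 0<⇒≢0 0<a

  a′≢0 : ¬ a′ ≡ 0ℤ
  a′≢0 = 0<⇒≢0 0<a′

  a″≢0 : ¬ a″ ≡ 0ℤ
  a″≢0 = 0<⇒≢0 0<a″

  composable : Composable Q Q″
  composable = concordant⇒composable Q Q″ (trans D≡d (sym D″≡d)) concordant

  open Middle Q Q″ D≡d D″≡d composable public using (exists; unique)

  module L = FormLattice d<0 Q D≡d a≢0
  module L′ = FormLattice d<0 Q′ D′≡d a′≢0
  open RayClass d<0 L.𝒪·𝒪⊆𝒪 𝔫-submodule N N∈𝔫

  w w′ w″ jγ : K d
  w = ω Q
  w′ = ω Q′
  w″ = ω Q″
  jγ = j γ w″

  open Möbius d<0 (ω-^ d<0 Q′ γ D′≡d a′≢0 a″≢0) using () renaming (j≢0 to jγ≢0; into to into-γ; from to from-γ)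

  II′ : Pred (K d) 0ℓ
  II′ = [ w , 1ₖ ] · [ w′ , 1ₖ ]

  II′-submodule : IsℤSubmodule II′
  II′-submodule = ·-submodule (lattice w 1ₖ)

  1∈II′ : 1ₖ ∈ II′
  1∈II′ = subst II′ (1·ₖ 1ₖ) (·-∈ L.1∈I L′.1∈I)

  aa′II′⊆𝒪 : ∀ {x} → x ∈ II′ → ι (a * a′) *ₖ x ∈ 𝒪
  aa′II′⊆𝒪 = ·-⊆ (⁻¹·-submodule (ι (a * a′)) 𝒪-submodule) λ {x} {y} x∈ y∈ →
    subst 𝒪 (trans (solve 4 (λ a a′ x y → a :* x :* (a′ :* y) := a :* a′ :* (x :* y)) refl (ι a) (ι a′) x y)
                   (cong (_*ₖ (x *ₖ y)) (sym (ι-* a a′))))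
      (L.𝒪·𝒪⊆𝒪 (L.aI⊆𝒪 x∈) (L′.aI⊆𝒪 y∈))

  module _ (B : ℤ) (h : IsMiddleCoefficient d Q Q″ B) where

    open IsMiddleCoefficient h

    X Y E : ℤ
    X = _∣_.quotient B≡b
    Y = _∣_.quotient B≡b″
    E = _∣_.quotient B²≡d

    open Dirichlet d<0 Q Q″ D≡d D″≡d a≢0 a″≢0 composable B X Y E
      (_∣_.equality B≡b) (_∣_.equality B≡b″) (_∣_.equality B²≡d) using (C; θ; w″≡; aa″≢0; disc-C; product⊆; ⊆product; module LC)
    open LowerRowCoefficients {d} {N} Q Q′ γ B Y E D″≡d a″≢0 (_∣_.equality B≡b″) (_∣_.equality B²≡d)
      (𝒬[_].prime Q∈𝒬) (𝒬[_].prime Q′∈𝒬)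

    into-II′ : ∀ {x} → x ∈ II′ → jγ *ₖ x ∈ [ θ , 1ₖ ]
    into-II′ = ·-⊆ (⁻¹·-submodule jγ (lattice θ 1ₖ)) λ {x} {y} x∈ y∈ →
      subst [ θ , 1ₖ ] (solve 3 (λ x y j → x :* (j :* y) := j :* (x :* y)) refl x y jγ) (product⊆ x∈ (into-γ y∈))

    -- The factor `j⁻¹` is moved onto the second factor of each product, where it carries `[w″ , 1]`
    -- back to `[w′ , 1]`.
    from-II′ : ∀ {x} → jγ *ₖ x ∈ [ θ , 1ₖ ] → x ∈ II′
    from-II′ {x} jx∈ = subst II′ (j⁻¹·j x) (·-⊆ (⁻¹·-submodule (invₖ jγ) II′-submodule) (λ {y} {z} y∈ z∈ →
        subst II′ (solve 3 (λ i y z → y :* (i :* z) := i :* (y :* z)) refl (invₖ jγ) y z)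
          (·-∈ y∈ (from-γ (subst [ w″ , 1ₖ ] (sym (j·j⁻¹ z)) z∈)))) (⊆product jx∈))
      where
      j·j⁻¹ : ∀ z → jγ *ₖ (invₖ jγ *ₖ z) ≡ z
      j·j⁻¹ z = linₖ z (invₖ-inverse d<0 jγ jγ≢0) (solve 3 (λ j i z → j :* (i :* z) := z :+ z :* (j :* i :- con 1ℤ)) refl jγ (invₖ jγ) z)
      j⁻¹·j : ∀ z → invₖ jγ *ₖ (jγ *ₖ z) ≡ z
      j⁻¹·j z = linₖ z (invₖ-inverse d<0 jγ jγ≢0) (solve 3 (λ j i z → i :* (j :* z) := z :+ z :* (j :* i :- con 1ℤ)) refl jγ (invₖ jγ) z)

    jγ≡ : jγ ≡ ι u *ₖ θ +ₖ ι v
    jγ≡ = linₖ (ι r) w″≡ (linₖ (negₖ θ)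
      (ι-equation 3 (λ u r a → u := r :* a) (u ∷ r ∷ a ∷ []) refl) (linₖ (negₖ 1ₖ)
      (ι-equation 4 (λ v r Y s → v := r :* Y :+ s) (v ∷ r ∷ Y ∷ s ∷ []) refl)
      (solve 8 (λ r s w″ a θ Y u v → r :* w″ :+ s := u :* θ :+ v :+ r :* (w″ :- (a :* θ :+ Y))
        :+ :- θ :* (u :- r :* a) :+ :- con 1ℤ :* (v :- (r :* Y :+ s))) refl
        (ι r) (ι s) w″ (ι a) θ (ι Y) (ι u) (ι v))))

    Represents1 : ℤ → ℤ → Set
    Represents1 u v = 1ₖ {d} ≡ fromℤ u *ₖ ν₁ Q Q″ γ B +ₖ fromℤ v *ₖ ν₂ Q″ γ

    jν₁≡θ : jγ *ₖ ν₁ Q Q″ γ B ≡ θ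
    jν₁≡θ = *ₖ-cancelˡ d<0 2A≢0 (trans (trans
        (solve 3 (λ A j n → A :* (j :* n) := A :* j :* n) refl 2A jγ (ν₁ Q Q″ γ B))
        (/ₖ-*ₖ d<0 (ι (- B) +ₖ √disc) 2Aj≢0)) (sym LC.ω-equation))
      where
      2A = ι {d} (+ 2 * (a * a″))
      2A≢0 : ¬ 2A ≡ 0ₖ
      2A≢0 = ι-≢0 (λ eq → aa″≢0 (*-≢0-cancelˡ (+ 2) (λ ()) eq))
      2Aj≢0 : ¬ 2A *ₖ jγ ≡ 0ₖ
      2Aj≢0 eq = jγ≢0 (*ₖ-cancelˡ d<0 2A≢0 (trans eq (solve 1 (λ A → con 0ℤ := A :* con 0ℤ) refl 2A)))

    jν₂≡1 : jγ *ₖ ν₂ Q″ γ ≡ 1ₖ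
    jν₂≡1 = /ₖ-*ₖ d<0 1ₖ jγ≢0

    j[uν₁+vν₂] : ∀ u v → jγ *ₖ (ι u *ₖ ν₁ Q Q″ γ B +ₖ ι v *ₖ ν₂ Q″ γ) ≡ ι u *ₖ θ +ₖ ι v
    j[uν₁+vν₂] u v = linₖ (ι u) jν₁≡θ (linₖ (ι v) jν₂≡1
      (solve 6 (λ u v j n₁ n₂ θ → j :* (u :* n₁ :+ v :* n₂) := u :* θ :+ v
        :+ u :* (j :* n₁ :- θ) :+ v :* (j :* n₂ :- con 1ℤ)) refl (ι u) (ι v) jγ (ν₁ Q Q″ γ B) (ν₂ Q″ γ) θ))

    represents-exists : ∃₂ λ u v → Represents1 u v
    represents-exists = u , v , *ₖ-cancelˡ d<0 jγ≢0 (trans (solve 1 (λ j → j :* con 1ℤ := j) refl jγ)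
      (trans jγ≡ (sym (j[uν₁+vν₂] u v))))

    -- Multiplication by `j` sends `ν₁` and `ν₂` to `θ` and 1, so any representation of 1 gives
    -- coordinates of `j` in an independent pair.
    represents-unique : ∀ u′ v′ → Represents1 u′ v′ → u ≡ u′ × v ≡ v′
    represents-unique u′ v′ eq = LC.independent (trans (sym jγ≡)
      (trans (solve 1 (λ j → j := j :* con 1ℤ) refl jγ) (trans (cong (jγ *ₖ_) eq) (j[uν₁+vν₂] u′ v′))))

    row-exists : ∃ λ σ → LowerRow σ u v N
    row-exists = lift-lower-row u v N 0<N bezout-uvN

    module _ (σ : SL₂ℤ) (row : LowerRow σ u v N) where

      R : Form
      R = composite Q Q″ h ^ (σ ⁻¹)

      disc-R : disc R ≡ d
      disc-R = trans (disc-^ C (σ ⁻¹)) disc-C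

      C>0 : PositiveDefinite C
      C>0 = positiveDefinite C (*-pos 0<a 0<a″) (subst (_< 0ℤ) (sym disc-C) d<0)

      R>0 : PositiveDefinite R
      R>0 = positiveDefinite-^ {C} (σ ⁻¹) C>0

      aR≢0 : ¬ Form.a R ≡ 0ℤ
      aR≢0 = 0<⇒≢0 (leading-positive R R>0)

      R∈𝒬 : 𝒬[ N ] d R
      R∈𝒬 = record
        { inQ = record
          { isPrimitive = isPrimitive-of-fundamental d-fundamental (Form.a R) (Form.b R) (Form.c R) disc-R
          ; positiveDefinite = R>0
          ; discriminant = disc-R }
        ; prime = value-prime σ row }

      ρ jσ : K d
      ρ = ω R
      jσ = j σ θ

      module LR = FormLattice d<0 R disc-R aR≢0

      open Möbius d<0 (möbius-⁻¹ d<0 {σ} (ω-^ d<0 C (σ ⁻¹) disc-C aa″≢0 aR≢0))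
        using () renaming (j≢0 to jσ≢0; into to into-σ; from to from-σ)

      k l : ℤ
      k = _∣_.quotient (proj₁ row)
      l = _∣_.quotient (proj₂ row)

      jσ≡ : jσ ≡ jγ +ₖ ι (+ N) *ₖ (ι k *ₖ θ +ₖ ι l *ₖ 1ₖ)
      jσ≡ = linₖ (negₖ 1ₖ) jγ≡ (linₖ θ (ι-row (SL₂ℤ.r σ) u k (_∣_.equality (proj₁ row))) (linₖ 1ₖ (ι-row (SL₂ℤ.s σ) v l (_∣_.equality (proj₂ row)))
        (solve 9 (λ rσ sσ u v k l N θ j → rσ :* θ :+ sσ := j :+ N :* (k :* θ :+ l :* con 1ℤ)
          :+ :- con 1ℤ :* (j :- (u :* θ :+ v)) :+ θ :* (rσ :- u :- k :* N) :+ con 1ℤ :* (sσ :- v :- l :* N)) refl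
          (ι (SL₂ℤ.r σ)) (ι (SL₂ℤ.s σ)) (ι u) (ι v) (ι k) (ι l) (ι (+ N)) θ jγ)))
        where
        ι-row : ∀ x y k → x - y ≡ k * + N → ι {d} x +ₖ negₖ (ι y) ≡ ι k *ₖ ι (+ N)
        ι-row x y k = ι-equation 4 (λ x y k N → x :- y := k :* N) (x ∷ y ∷ k ∷ + N ∷ [])

      -- Chosen so that `Ny = (t - j)/j`, where `t` is `jσ` and `j` is `jγ`. Thus `1 + Ny = t/j`.
      y : K d
      y = invₖ jγ *ₖ (ι k *ₖ θ +ₖ ι l *ₖ 1ₖ)

      jy≡ : jγ *ₖ y ≡ ι k *ₖ θ +ₖ ι l *ₖ 1ₖ
      jy≡ = linₖ z (invₖ-inverse d<0 jγ jγ≢0)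
        (solve 3 (λ j i z → j :* (i :* z) := z :+ z :* (j :* i :- con 1ℤ)) refl jγ (invₖ jγ) z)
        where z = ι k *ₖ θ +ₖ ι l *ₖ 1ₖ

      y∈II′ : y ∈ II′
      y∈II′ = from-II′ (subst [ θ , 1ₖ ] (sym jy≡) (combination∈ θ 1ₖ k l))

      aa′≢0 : ¬ a * a′ ≡ 0ℤ
      aa′≢0 = 0<⇒≢0 (*-pos 0<a 0<a′)

      ν : K d
      ν = 1+Ny aa′≢0 aa′-prime (aa′II′⊆𝒪 y∈II′)

      jν≡ : jγ *ₖ ν ≡ jσ
      jν≡ = *ₖ-cancelˡ d<0 (ι-≢0 aa′≢0) (linₖ jγ (k[1+Ny] aa′≢0 aa′-prime (aa′II′⊆𝒪 y∈II′))
        (linₖ (ι (+ N) *ₖ ι (a * a′)) jy≡ (linₖ (negₖ (ι (a * a′))) jσ≡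
        (solve 7 (λ A j n t N y z → A :* (j :* n) := A :* t :+ j :* (A :* n :- (A :+ N :* (A :* y)))
          :+ N :* A :* (j :* y :- z) :+ :- A :* (t :- (j :+ N :* z))) refl
          (ι (a * a′)) jγ ν jσ (ι (+ N)) y (ι k *ₖ θ +ₖ ι l *ₖ 1ₖ)))))

      ν≢0 : ¬ ν ≡ 0ₖ
      ν≢0 ν≡0 = jσ≢0 (trans (sym jν≡) (trans (cong (jγ *ₖ_) ν≡0) (solve 1 (λ j → j :* con 0ℤ := con 0ℤ) refl jγ)))

      -- For one inclusion, `x` is written as the single product `(t⁻¹jx)ν`. For the other, the
      -- multiples of `ν` by 𝒪 are absorbed by `[ρ , 1]`, which is stable under 𝒪.
      coset : II′ ≐ [ ρ , 1ₖ ] · ⟨ ν ⟩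
      coset = ⊆ρν , ·-⊆ II′-submodule (λ {x} x∈ → λ { (α , α∈ , refl) → from-II′
          (subst [ θ , 1ₖ ] (linₖ (negₖ (x *ₖ α)) jν≡
             (solve 5 (λ t α x j n → t :* (α :* x) := j :* (x :* (n :* α)) :+ :- (x :* α) :* (j :* n :- t)) refl jσ α x jγ ν))
            (into-σ (LR.𝒪-closed α∈ x∈))) })
        where
        ⊆ρν : II′ ⊆ [ ρ , 1ₖ ] · ⟨ ν ⟩
        ⊆ρν {x} x∈ = subst ([ ρ , 1ₖ ] · ⟨ ν ⟩)
            (linₖ (x *ₖ invₖ jσ) jν≡ (linₖ x (invₖ-inverse d<0 jσ jσ≢0)
              (solve 5 (λ i j x n t → i :* (j :* x) :* (n :* con 1ℤ) := x :+ x :* i :* (j :* n :- t) :+ x :* (t :* i :- con 1ℤ)) refl (invₖ jσ) jγ x ν jσ)))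
            (·-∈ (from-σ (subst [ θ , 1ₖ ] (sym t·t⁻¹) (into-II′ x∈))) (1ₖ , 1∈𝒪 , refl))
          where
          t·t⁻¹ : jσ *ₖ (invₖ jσ *ₖ (jγ *ₖ x)) ≡ jγ *ₖ x
          t·t⁻¹ = linₖ (jγ *ₖ x) (invₖ-inverse d<0 jσ jσ≢0)
            (solve 3 (λ t i z → t :* (i :* z) := z :+ z :* (t :* i :- con 1ℤ)) refl jσ (invₖ jσ) (jγ *ₖ x))

      class-equation : [ Q ][ Q′ ]≡[ R ]mod 𝔫
      class-equation = record
        { I∈I_K[𝔫] = isPrimeTo (·-𝒪submodule L.I-𝒪submodule L.1∈I L′.1∈I) 1∈II′ (a * a′) aa′≢0 aa′II′⊆𝒪 aa′-prime
        ; J∈I_K[𝔫] = isPrimeTo LR.I-𝒪submodule LR.1∈I (Form.a R) aR≢0 LR.aI⊆𝒪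
            (let n , m , eq = gcd≡1⇒bezout (+ N) (Form.a R) (value-prime σ row) in m , n , trans (ℤ.+-comm (m * Form.a R) (n * + N)) eq)
        ; ν = ν
        ; ν≡*1 = 1+Ny≡*1 aa′≢0 aa′-prime (aa′II′⊆𝒪 y∈II′) ν≢0
        ; coset = coset
        }

mainTheorem4 : (d : ℤ) → IsImaginaryQuadraticDiscriminant d →
    (𝔫 : Pred (K d) 0ℓ) → IsNonzeroIdeal 𝔫 →
    (N : ℕ) → IsLeastPositiveInteger 𝔫 N →
    (Q Q′ : Form) → 𝒬[ N ] d Q → 𝒬[ N ] d Q′ →
    (∃ λ γ → Concordant Q (Q′ ^ γ)) ×
    (∀ γ → let Q″ = Q′ ^ γ in Concordant Q Q″ →
    (∃ λ B → IsMiddleCoefficient d Q Q″ B) ×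
    (∀ B B′ → IsMiddleCoefficient d Q Q″ B → IsMiddleCoefficient d Q Q″ B′ →
    B ≡ B′ [modℤ + 2 * (Form.a Q * Form.a Q″) ]) ×
    (∀ B → (h : IsMiddleCoefficient d Q Q″ B) →
    let Represents1 = λ (u v : ℤ) → 1ₖ {d} ≡ fromℤ u *ₖ ν₁ Q Q″ γ B +ₖ fromℤ v *ₖ ν₂ Q″ γ in
    (∃₂ λ u v → Represents1 u v) ×
    (∀ u v → Represents1 u v →
    (∃ λ σ → LowerRow σ u v N) ×
    (∀ σ → LowerRow σ u v N →
    let R = composite Q Q″ h ^ (σ ⁻¹) in
    𝒬[ N ] d R × ([ Q ][ Q′ ]≡[ R ]mod 𝔫)))))
mainTheorem4 d d-fundamental 𝔫 𝔫-ideal N N-least Q Q′ Q∈𝒬 Q′∈𝒬 =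
    concordant-translate Q Q′ (0<⇒≢0 (leading-positive Q (𝒬.positiveDefinite (𝒬[_].inQ Q∈𝒬)))) (𝒬.isPrimitive (𝒬[_].inQ Q′∈𝒬))
  , λ γ concordant →
      let module C = Composition d-fundamental (IsNonzeroIdeal.submodule 𝔫-ideal) N (IsLeastPositiveInteger.positive N-least)
                       (IsLeastPositiveInteger.member N-least) Q Q′ Q∈𝒬 Q′∈𝒬 γ concordant
      in C.exists , C.unique , λ B h → C.represents-exists B h , λ u v represents →
           -- The given `u`, `v` must be the explicit coordinates for which the lift and the class
           -- equation were proved, so those results are transported along the equalities.
           let u≡ , v≡ = C.represents-unique B h u v represents
           in subst₂ (λ u v → ∃ λ σ → LowerRow σ u v N) u≡ v≡ (C.row-exists B h)
            , λ σ row → let row′ = subst₂ (λ u v → LowerRow σ u v N) (sym u≡) (sym v≡) row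
                        in C.R∈𝒬 B h σ row′ , C.class-equation B h σ row′
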